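{- Let $\mathcal{H}$ be a fixed finite set of connected graphs, let $D$ be the maximum diameter of the graphs in $\mathcal{H}$, and let $\Delta>1$ be an integer. Put $p=\log_{\frac{2\Delta}{2\Delta-1}}\Delta$. Consider the following procedure, applied to an instance $(G,k)$ of $\mathcal{H}$-free Edge Deletion in which $G$ has maximum degree at most $\Delta$ and $G$ contains at least one induced copy of some graph in $\mathcal{H}$: (1) Delete from $G$ all vertices whose distance from $V_{\mathcal{H}}(G)$ is more than $(1+\log_{\frac{2\Delta}{2\Delta-1}}k)D$; call the resulting graph $G'$. (2) If $|V(G')|>2\Delta^{2D+1}\cdot k^{pD+1}$, output the instance $(H_0,0)$, where $H_0$ is a graph in $\mathcal{H}$ with the minimum number of vertices; otherwise output $(G',k)$. Then the output instance has at most $2\Delta^{2D+1}\cdot k^{pD+1}$ vertices, and it is a yes-instance of $\mathcal{H}$-free Edge Deletion if and only if $(G,k)$ is a yes-instance.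
   Context: All graphs are finite and simple. For a set of graphs $\mathcal{H}$, a graph is $\mathcal{H}$-free if it has no induced subgraph isomorphic to a member of $\mathcal{H}$. The problem $\mathcal{H}$-free Edge Deletion: given a graph $G$ and a positive integer $k$ (the parameter), decide whether there exists $E'\subseteq E(G)$ with $|E'|\le k$ such that $G\setminus E'=(V(G),E(G)\setminus E')$ is $\mathcal{H}$-free. $V_{\mathcal{H}}(G)$ denotes the set of all vertices of $G$ that belong to some induced subgraph of $G$ isomorphic to a member of $\mathcal{H}$. The distance from a vertex $v$ to a set of vertices $V'$ is the minimum of the distances from $v$ to the vertices of $V'$. -}

module Defs where

open import Data.Nat using (ℕ; zero; suc; _+_; _*_; _∸_; _^_; _≤_; _<_)
open import Data.Fin using (Fin; toℕ)
open import Data.Bool using (Bool; true; false; if_then_else_; _∧_; not)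
open import Data.Nat using (_<ᵇ_)
open import Data.List using (List; map; allFin)
open import Data.Nat.ListAction using (sum)
open import Data.List.Membership.Propositional using (_∈_)
open import Data.Product using (Σ; ∃; _×_; _,_; ∃-syntax)
open import Relation.Binary.PropositionalEquality using (_≡_)
open import Relation.Nullary using (¬_)
open import Function.Definitions using (Injective)

record Graph : Set where
  field
    n      : ℕ
    adj    : Fin n → Fin n → Bool
    sym    : ∀ i j → adj i j ≡ adj j i
    irrefl : ∀ i → adj i i ≡ false
open Graph public

data Walk (G : Graph) : Fin (n G) → Fin (n G) → ℕ → Set where
  nil  : ∀ {u} → Walk G u u 0
  cons : ∀ {u w v ℓ} → adj G u w ≡ true → Walk G w v ℓ → Walk G u (v) (suc ℓ)

DistLe : (G : Graph) → Fin (n G) → Fin (n G) → ℕ → Set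
DistLe G u v t = ∃[ ℓ ] (ℓ ≤ t × Walk G u v ℓ)

Connected : Graph → Set
Connected G = ∀ u v → ∃[ ℓ ] Walk G u v ℓ

IsMaxDiameter : List Graph → ℕ → Set
IsMaxDiameter ℋ D =
  (∀ H → H ∈ ℋ → ∀ u v → DistLe H u v D) ×
  (∃[ H ] (H ∈ ℋ × ∃[ u ] ∃[ v ] (DistLe H u v D × (∀ ℓ → Walk H u v ℓ → D ≤ ℓ))))

InducedEmbedding : Graph → Graph → Set
InducedEmbedding H G =
  Σ (Fin (n H) → Fin (n G)) λ f →
    Injective _≡_ _≡_ f × (∀ i j → adj H i j ≡ adj G (f i) (f j))

HFree : List Graph → Graph → Set
HFree ℋ G = ∀ H → H ∈ ℋ → ¬ InducedEmbedding H G

InVH : List Graph → (G : Graph) → Fin (n G) → Set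
InVH ℋ G v = ∃[ H ] (H ∈ ℋ × Σ (InducedEmbedding H G) λ e → ∃[ i ] (Data.Product.proj₁ e i ≡ v))
  where import Data.Product

indicator : Bool → ℕ
indicator b = if b then 1 else 0

degree : (G : Graph) → Fin (n G) → ℕ
degree G v = sum (map (λ j → indicator (adj G v j)) (allFin (n G)))

MaxDegreeLe : Graph → ℕ → Set
MaxDegreeLe G Δ = ∀ v → degree G v ≤ Δ

-- A spanning subgraph G \ E' of G (E' = edges of G that are not edges of G \ E').
record Deletion (G : Graph) : Set where
  field
    adj'    : Fin (n G) → Fin (n G) → Bool
    sym'    : ∀ i j → adj' i j ≡ adj' j i
    irrefl' : ∀ i → adj' i i ≡ false
    sub'    : ∀ i j → adj' i j ≡ true → adj G i j ≡ true
open Deletion public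

result : (G : Graph) → Deletion G → Graph
result G F = record { n = n G ; adj = adj' F ; sym = sym' F ; irrefl = irrefl' F }

deletedCount : (G : Graph) → Deletion G → ℕ
deletedCount G F =
  sum (map (λ i → sum (map (λ j →
    indicator ((toℕ i <ᵇ toℕ j) ∧ (adj G i j ∧ not (adj' F i j))))
    (allFin (n G)))) (allFin (n G)))

YesInstance : List Graph → Graph → ℕ → Set
YesInstance ℋ G k = Σ (Deletion G) λ F → deletedCount G F ≤ k × HFree ℋ (result G F)

-- Threshold for step (1):  d ≤ (1 + log_b k) D  with  b = 2Δ/(2Δ-1),
-- written exactly in integer arithmetic as  b^d ≤ k^D b^D, i.e.
--   (2Δ)^d (2Δ-1)^D ≤ k^D (2Δ)^D (2Δ-1)^d.
ThresholdLe : ℕ → ℕ → ℕ → ℕ → Set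
ThresholdLe Δ D k d = (2 * Δ) ^ d * (2 * Δ ∸ 1) ^ D ≤ k ^ D * (2 * Δ) ^ D * (2 * Δ ∸ 1) ^ d

-- x ≤ 2 Δ^(2D+1) k^(pD+1) with p = log_b Δ, b = 2Δ/(2Δ-1) (k ≥ 1, Δ ≥ 2),
-- written exactly via rational exponents r/s:
--   for all r, s with s ≥ 1:  if x^s > (2 Δ^(2D+1) k)^s Δ^(D r)  then  b^r ≤ k^s.
BoundLe : ℕ → ℕ → ℕ → ℕ → Set
BoundLe Δ D k x =
  ∀ r s → 1 ≤ s →
    (2 * Δ ^ (2 * D + 1) * k) ^ s * Δ ^ (D * r) < x ^ s →
    (2 * Δ) ^ r ≤ k ^ s * (2 * Δ ∸ 1) ^ r

Kept : List Graph → ℕ → ℕ → ℕ → (G : Graph) → Fin (n G) → Set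
Kept ℋ Δ D k G v = ∃[ u ] (InVH ℋ G u × ∃[ d ] (Walk G v u d × ThresholdLe Δ D k d))

IsStep1Graph : List Graph → ℕ → ℕ → ℕ → (G G' : Graph) → (Fin (n G') → Fin (n G)) → Set
IsStep1Graph ℋ Δ D k G G' ι =
  Injective _≡_ _≡_ ι ×
  (∀ i j → adj G' i j ≡ adj G (ι i) (ι j)) ×
  (∀ v → Kept ℋ Δ D k G v → ∃[ i ] (ι i ≡ v)) ×
  (∀ i → Kept ℋ Δ D k G (ι i))

-- Call a solution F of G' local if every edge it deletes is within j D of V_ℋ, for some j with
-- b ^ j ≤ k, b = 2Δ / (2Δ - 1). A local solution of G' also solves G: a copy in G - F that is
-- not a copy in G contains a deleted edge, and by its diameter lies within (j + 1) D of V_ℋ,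
-- hence in G'.
--
-- A minimum solution is local. Let r_j count the edges of F not inside the ball of radius
-- (j - 1) D around V_ℋ. Restore those edges, and instead delete all edges at endpoints of the t_j
-- restored edges that lie inside the ball of radius j D. This is again a solution, so
-- r_j ≤ 2Δ t_j = 2Δ (r_j - r_(j+1)), and the r_j decay geometrically with ratio 1 / b.
-- Conversely, if (G , k) is solvable, V(G') is covered by k balls of radius (2 + log_b k) D
-- around one endpoint of each deleted edge.

module Submission where

open import Defs
open import Data.Bool using (Bool; true; false; _∧_; not)
import Data.Bool.Properties as Bool
open import Data.Empty using (⊥; ⊥-elim)
open import Data.Fin using (Fin; toℕ)
open import Data.Fin.Properties using (_≟_; any?; all?; injective⇒≤; toℕ-injective)
open import Data.List using (List; []; _∷_; map; length; concatMap; filter; allFin; lookup)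
open import Data.List.Membership.Propositional using (_∈_; find; lose)
open import Data.List.Membership.Propositional.Properties
  using (∈-allFin; ∈-concatMap⁺; ∈-filter⁺; ∈-map⁺)
open import Data.List.Properties using (length-++; length-map)
open import Data.List.Relation.Unary.All as All using (All)
open import Data.List.Relation.Unary.AllPairs using (_∷_)
import Data.List.Relation.Unary.Any as Any
open import Data.List.Relation.Unary.Any using (here; there)
open import Data.List.Relation.Unary.Any.Properties using (lookup-index)
open import Data.List.Relation.Unary.Unique.Propositional using (Unique)
open import Data.List.Relation.Unary.Unique.Propositional.Properties using (allFin⁺)
open import Data.Nat hiding (_≟_)
open import Data.Nat.DivMod using (m/n*n≤m; m*n/n≡m; /-monoˡ-≤)
open import Data.Nat.ListAction using (sum)
open import Data.Nat.Properties hiding (_≟_)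
open import Data.Nat.Tactic.RingSolver using (solve-∀)
open import Data.Product using (Σ; ∃; ∃-syntax; _×_; _,_; proj₁; proj₂)
open import Data.Sum using (_⊎_; inj₁; inj₂)
open import Data.Vec as Vec using (Vec)
open import Data.Vec.Properties using (lookup∘tabulate)
open import Function.Base using (_∘_; id)
open import Function.Bundles using (_⇔_; mk⇔)
open import Function.Definitions using (Injective)
open import Relation.Binary.Definitions using (tri<; tri≈; tri>)
open import Relation.Binary.PropositionalEquality
  using (_≡_; _≢_; refl; cong; cong₂; trans; subst; subst₂) renaming (sym to ≡-sym)
open import Relation.Nullary using (¬_; Dec; yes; no; does; contradiction)
open import Relation.Nullary.Decidable
  using (map′; dec-true; dec-false; decidable-stable; does-⇔; ¬?; _×-dec_; _⊎-dec_; _→-dec_)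

-- Arithmetic of the thresholds, with b = a / c

^-distribʳ-* : ∀ x y m → (x * y) ^ m ≡ x ^ m * y ^ m
^-distribʳ-* x y zero    = refl
^-distribʳ-* x y (suc m) =
  trans (cong (x * y *_) (^-distribʳ-* x y m)) (interchange x y (x ^ m) (y ^ m))
  where
  interchange : ∀ x y p q → x * y * (p * q) ≡ x * p * (y * q)
  interchange = solve-∀

module _ (a c k D : ℕ) (1≤c : 1 ≤ c) (c<a : c < a) where

  private instance
    a≢0 : NonZero a
    a≢0 = >-nonZero (≤-trans (s≤s z≤n) c<a)

    c≢0 : NonZero c
    c≢0 = >-nonZero 1≤c

  -- From b^i ≤ k follows b^d ≤ b^(D + iD) = b^D (b^i)^D ≤ b^D k^D. Both sides are multiplied by
  -- a^e, with `e` the slack between d and D + iD, so that no exponent is ever subtracted.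
  threshold-from-log : ∀ i d → a ^ i ≤ k * c ^ i → d ≤ D + i * D →
                       a ^ d * c ^ D ≤ k ^ D * a ^ D * c ^ d
  threshold-from-log i d aⁱ≤kcⁱ d≤ with m≤n⇒∃[o]m+o≡n d≤
  ... | e , d+e≡ = *-cancelʳ-≤ _ _ (a ^ e) {{m^n≢0 a e}} (begin
    a ^ d * c ^ D * a ^ e              ≡⟨ swapʳ (a ^ d) (c ^ D) (a ^ e) ⟩
    a ^ d * a ^ e * c ^ D              ≡⟨ cong (_* c ^ D) (≡-sym (^-distribˡ-+-* a d e)) ⟩
    a ^ (d + e) * c ^ D                ≡⟨ cong (λ m → a ^ m * c ^ D) d+e≡ ⟩
    a ^ (D + i * D) * c ^ D            ≡⟨ cong (_* c ^ D) (split a) ⟩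
    a ^ D * (a ^ i) ^ D * c ^ D        ≤⟨ *-monoˡ-≤ (c ^ D) (*-monoʳ-≤ (a ^ D) (^-monoˡ-≤ D aⁱ≤kcⁱ)) ⟩
    a ^ D * (k * c ^ i) ^ D * c ^ D    ≡⟨ cong (λ m → a ^ D * m * c ^ D) (^-distribʳ-* k (c ^ i) D) ⟩
    a ^ D * (k ^ D * (c ^ i) ^ D) * c ^ D
                                       ≡⟨ regroup (a ^ D) (k ^ D) ((c ^ i) ^ D) (c ^ D) ⟩
    k ^ D * a ^ D * (c ^ D * (c ^ i) ^ D)
                                       ≡⟨ cong (k ^ D * a ^ D *_) (≡-sym (split c)) ⟩
    k ^ D * a ^ D * c ^ (D + i * D)    ≡⟨ cong (λ m → k ^ D * a ^ D * c ^ m) (≡-sym d+e≡) ⟩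
    k ^ D * a ^ D * c ^ (d + e)        ≡⟨ cong (k ^ D * a ^ D *_) (^-distribˡ-+-* c d e) ⟩
    k ^ D * a ^ D * (c ^ d * c ^ e)    ≤⟨ *-monoʳ-≤ (k ^ D * a ^ D) (*-monoʳ-≤ (c ^ d) (^-monoˡ-≤ e (<⇒≤ c<a))) ⟩
    k ^ D * a ^ D * (c ^ d * a ^ e)    ≡⟨ ≡-sym (*-assoc (k ^ D * a ^ D) (c ^ d) (a ^ e)) ⟩
    k ^ D * a ^ D * c ^ d * a ^ e      ∎)
    where
    open ≤-Reasoning
    split : ∀ m → m ^ (D + i * D) ≡ m ^ D * (m ^ i) ^ D
    split m = trans (^-distribˡ-+-* m D (i * D)) (cong (m ^ D *_) (≡-sym (^-*-assoc m i D)))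
    swapʳ : ∀ x y z → x * y * z ≡ x * z * y
    swapʳ = solve-∀
    regroup : ∀ x y z w → x * (y * z) * w ≡ y * x * (w * z)
    regroup = solve-∀

  -- Strict growth of powers of b with denominators cleared, from c^(t+1) < a^(t+1). It turns
  -- comparisons of powers into comparisons of exponents.
  power-gap : ∀ {m M} → M < m → a ^ M * c ^ m < a ^ m * c ^ M
  power-gap {m} {M} M<m with m≤n⇒∃[o]m+o≡n M<m
  ... | t , refl = subst₂ _<_
    (trans (*-assoc (a ^ M) (c ^ M) _) (cong (a ^ M *_) (exponent c)))
    (trans (swapʳ (a ^ M) (c ^ M) _) (cong (_* c ^ M) (exponent a)))
    (*-monoʳ-< (a ^ M * c ^ M) {{m*n≢0 (a ^ M) (c ^ M) {{m^n≢0 a M}} {{m^n≢0 c M}}}}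
      (^-monoˡ-< (suc t) c<a))
    where
    exponent : ∀ x → x ^ M * x ^ suc t ≡ x ^ suc (M + t)
    exponent x = trans (≡-sym (^-distribˡ-+-* x M (suc t))) (cong (x ^_) (+-suc M t))
    swapʳ : ∀ x y z → x * y * z ≡ x * z * y
    swapʳ = solve-∀

  -- The hypothesis k^s < b^r puts r/s above log_b k, so d ≤ (1 + log_b k) D gives d ≤ D + D r/s.
  -- Otherwise the `s`-th power of the threshold and the `D`-th power of k^s ≤ b^r would together
  -- contradict `power-gap`.
  threshold-exponent : ∀ r s d → k ^ s * c ^ r < a ^ r →
                       a ^ d * c ^ D ≤ k ^ D * a ^ D * c ^ d →
                       d * s ≤ D * s + D * r
  threshold-exponent r s d kˢcʳ<aʳ threshold = ≮⇒≥ λ M<m → <⇒≱ (power-gap M<m) (begin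
    a ^ (d * s) * c ^ (D * s + D * r)
      ≡⟨ cong (a ^ (d * s) *_) (^-distribˡ-+-* c (D * s) (D * r)) ⟩
    a ^ (d * s) * (c ^ (D * s) * c ^ (D * r))
      ≡⟨ ≡-sym (*-assoc (a ^ (d * s)) _ _) ⟩
    a ^ (d * s) * c ^ (D * s) * c ^ (D * r)
      ≡⟨ cong (_* c ^ (D * r)) (≡-sym (trans (^-distribʳ-* (a ^ d) (c ^ D) s)
           (cong₂ _*_ (^-*-assoc a d s) (^-*-assoc c D s)))) ⟩
    (a ^ d * c ^ D) ^ s * c ^ (D * r)
      ≤⟨ *-monoˡ-≤ (c ^ (D * r)) (^-monoˡ-≤ s threshold) ⟩
    (k ^ D * a ^ D * c ^ d) ^ s * c ^ (D * r)
      ≡⟨ cong (_* c ^ (D * r)) (trans (^-distribʳ-* (k ^ D * a ^ D) (c ^ d) s)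
           (cong₂ _*_ (trans (^-distribʳ-* (k ^ D) (a ^ D) s)
             (cong₂ _*_ (commuteExponents k) (^-*-assoc a D s))) (^-*-assoc c d s))) ⟩
    (k ^ s) ^ D * a ^ (D * s) * c ^ (d * s) * c ^ (D * r)
      ≡⟨ cong ((k ^ s) ^ D * a ^ (D * s) * c ^ (d * s) *_)
           (trans (cong (c ^_) (*-comm D r)) (≡-sym (^-*-assoc c r D))) ⟩
    (k ^ s) ^ D * a ^ (D * s) * c ^ (d * s) * (c ^ r) ^ D
      ≡⟨ regroup ((k ^ s) ^ D) (a ^ (D * s)) (c ^ (d * s)) ((c ^ r) ^ D) ⟩
    a ^ (D * s) * ((k ^ s) ^ D * (c ^ r) ^ D) * c ^ (d * s)
      ≡⟨ cong (λ m → a ^ (D * s) * m * c ^ (d * s)) (≡-sym (^-distribʳ-* (k ^ s) (c ^ r) D)) ⟩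
    a ^ (D * s) * (k ^ s * c ^ r) ^ D * c ^ (d * s)
      ≤⟨ *-monoˡ-≤ (c ^ (d * s)) (*-monoʳ-≤ (a ^ (D * s)) (^-monoˡ-≤ D (<⇒≤ kˢcʳ<aʳ))) ⟩
    a ^ (D * s) * (a ^ r) ^ D * c ^ (d * s)
      ≡⟨ cong (λ m → a ^ (D * s) * m * c ^ (d * s))
           (trans (^-*-assoc a r D) (cong (a ^_) (*-comm r D))) ⟩
    a ^ (D * s) * a ^ (D * r) * c ^ (d * s)
      ≡⟨ cong (_* c ^ (d * s)) (≡-sym (^-distribˡ-+-* a (D * s) (D * r))) ⟩
    a ^ (D * s + D * r) * c ^ (d * s) ∎)
    where
    open ≤-Reasoning
    commuteExponents : ∀ x → (x ^ D) ^ s ≡ (x ^ s) ^ D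
    commuteExponents x = trans (^-*-assoc x D s)
      (trans (cong (x ^_) (*-comm D s)) (≡-sym (^-*-assoc x s D)))
    regroup : ∀ x y z w → x * y * z * w ≡ y * (x * w) * z
    regroup = solve-∀

1≤2Δ∸1 : ∀ {Δ} → 2 ≤ Δ → 1 ≤ 2 * Δ ∸ 1
1≤2Δ∸1 2≤Δ = ≤-trans (s≤s z≤n) (∸-monoˡ-≤ 1 (*-monoʳ-≤ 2 2≤Δ))

2Δ∸1<2Δ : ∀ {Δ} → 2 ≤ Δ → 2 * Δ ∸ 1 < 2 * Δ
2Δ∸1<2Δ {Δ} 2≤Δ = ∸-monoʳ-< {2 * Δ} {1} {0} (s≤s z≤n) (≤-trans (s≤s z≤n) (*-monoʳ-≤ 2 2≤Δ))

-- If b^r > k^s, every threshold distance is at most D + (D * r) / s, so it is enough to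
-- bound x by that many applications of the branching factor Δ.
boundLe-from-balls : ∀ Δ D k x → 2 ≤ Δ →
  (∀ N → (∀ d → ThresholdLe Δ D k d → d ≤ N) → x ≤ k * Δ ^ suc (D + N)) →
  BoundLe Δ D k x
boundLe-from-balls Δ D k x 2≤Δ bound r (suc s′) _ large
  with (2 * Δ) ^ r ≤? k ^ suc s′ * (2 * Δ ∸ 1) ^ r
... | yes le = le
... | no ¬le = contradiction xˢ≤ (<⇒≱ large)
  where
  s N : ℕ
  s = suc s′
  N = (D * s + D * r) / s
  instance
    Δ≢0 : NonZero Δ
    Δ≢0 = >-nonZero (≤-trans (s≤s z≤n) 2≤Δ)
  d≤N : ∀ d → ThresholdLe Δ D k d → d ≤ N
  d≤N d threshold = subst (_≤ N) (m*n/n≡m d s) (/-monoˡ-≤ s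
    (threshold-exponent (2 * Δ) (2 * Δ ∸ 1) k D (1≤2Δ∸1 2≤Δ) (2Δ∸1<2Δ 2≤Δ) r s d (≰⇒> ¬le) threshold))
  open ≤-Reasoning
  -- Per factor `s`, the radius D + N contributes at most D + D + D r/s, and the outer `suc` is the
  -- 1 in 2D + 1.
  exponent-bound : suc (D + N) * s ≤ (2 * D + 1) * s + D * r
  exponent-bound = begin
    suc (D + N) * s                  ≡⟨ expand D N s ⟩
    (D + 1) * s + N * s              ≤⟨ +-monoʳ-≤ ((D + 1) * s) (m/n*n≤m (D * s + D * r) s) ⟩
    (D + 1) * s + (D * s + D * r)    ≡⟨ collect D s (D * r) ⟩
    (2 * D + 1) * s + D * r          ∎
    where
    expand : ∀ D N s → suc (D + N) * s ≡ (D + 1) * s + N * s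
    expand = solve-∀
    collect : ∀ D s e → (D + 1) * s + (D * s + e) ≡ (2 * D + 1) * s + e
    collect = solve-∀
  xˢ≤ : x ^ s ≤ (2 * Δ ^ (2 * D + 1) * k) ^ s * Δ ^ (D * r)
  xˢ≤ = begin
    x ^ s                                              ≤⟨ ^-monoˡ-≤ s (bound N d≤N) ⟩
    (k * Δ ^ suc (D + N)) ^ s                          ≡⟨ ^-distribʳ-* k _ s ⟩
    k ^ s * (Δ ^ suc (D + N)) ^ s                      ≡⟨ cong (k ^ s *_) (^-*-assoc Δ (suc (D + N)) s) ⟩
    k ^ s * Δ ^ (suc (D + N) * s)                      ≤⟨ *-monoʳ-≤ (k ^ s) (^-monoʳ-≤ Δ exponent-bound) ⟩
    k ^ s * Δ ^ ((2 * D + 1) * s + D * r)              ≡⟨ cong (k ^ s *_) (^-distribˡ-+-* Δ ((2 * D + 1) * s) (D * r)) ⟩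
    k ^ s * (Δ ^ ((2 * D + 1) * s) * Δ ^ (D * r))      ≡⟨ cong (λ m → k ^ s * (m * Δ ^ (D * r))) (≡-sym (^-*-assoc Δ (2 * D + 1) s)) ⟩
    k ^ s * ((Δ ^ (2 * D + 1)) ^ s * Δ ^ (D * r))      ≡⟨ regroup (k ^ s) ((Δ ^ (2 * D + 1)) ^ s) (Δ ^ (D * r)) ⟩
    (Δ ^ (2 * D + 1)) ^ s * k ^ s * Δ ^ (D * r)        ≡⟨ cong (_* Δ ^ (D * r)) (≡-sym (^-distribʳ-* (Δ ^ (2 * D + 1)) k s)) ⟩
    (Δ ^ (2 * D + 1) * k) ^ s * Δ ^ (D * r)            ≤⟨ *-monoˡ-≤ (Δ ^ (D * r)) (^-monoˡ-≤ s (*-monoˡ-≤ k (m≤n*m (Δ ^ (2 * D + 1)) 2))) ⟩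
    (2 * Δ ^ (2 * D + 1) * k) ^ s * Δ ^ (D * r)        ∎
    where
    regroup : ∀ x y z → x * (y * z) ≡ y * x * z
    regroup = solve-∀

-- Finite sums and counting

module _ {A : Set} where

  sum-map-mono : ∀ {f g : A → ℕ} → (∀ x → f x ≤ g x) → ∀ xs → sum (map f xs) ≤ sum (map g xs)
  sum-map-mono f≤g []       = z≤n
  sum-map-mono f≤g (x ∷ xs) = +-mono-≤ (f≤g x) (sum-map-mono f≤g xs)

  sum-map-+ : ∀ (f g : A → ℕ) xs →
              sum (map (λ x → f x + g x) xs) ≡ sum (map f xs) + sum (map g xs)
  sum-map-+ f g []       = refl
  sum-map-+ f g (x ∷ xs) =
    trans (cong (f x + g x +_) (sum-map-+ f g xs)) (interchange (f x) (g x) _ _)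
    where
    interchange : ∀ p q r t → p + q + (r + t) ≡ p + r + (q + t)
    interchange = solve-∀

  sum-map-*ˡ : ∀ c (f : A → ℕ) xs → sum (map (λ x → c * f x) xs) ≡ c * sum (map f xs)
  sum-map-*ˡ c f []       = ≡-sym (*-zeroʳ c)
  sum-map-*ˡ c f (x ∷ xs) =
    trans (cong (c * f x +_) (sum-map-*ˡ c f xs)) (≡-sym (*-distribˡ-+ c (f x) _))

  sum-map-0 : ∀ {f : A → ℕ} {xs} → (∀ {x} → x ∈ xs → f x ≡ 0) → sum (map f xs) ≡ 0
  sum-map-0 {xs = []}     f≡0 = refl
  sum-map-0 {xs = x ∷ xs} f≡0 = cong₂ _+_ (f≡0 (here refl)) (sum-map-0 (f≡0 ∘ there))

  ∈⇒≤sum-map : ∀ (f : A → ℕ) {x xs} → x ∈ xs → f x ≤ sum (map f xs)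
  ∈⇒≤sum-map f {xs = _ ∷ xs} (here refl) = m≤m+n _ _
  ∈⇒≤sum-map f {xs = y ∷ xs} (there x∈)  = ≤-trans (∈⇒≤sum-map f x∈) (m≤n+m _ (f y))

  -- Only one element can contribute, and `Unique` stops it from being summed twice.
  sum-map-≤-unique : ∀ {f : A → ℕ} {m xs} → Unique xs → (∀ x → f x ≤ m) →
                     (∀ {x y} → f x ≢ 0 → f y ≢ 0 → x ≡ y) → sum (map f xs) ≤ m
  sum-map-≤-unique {xs = []} _ _ _ = z≤n
  sum-map-≤-unique {f} {m} {xs = x ∷ xs} (x∉xs ∷ u) f≤m same with f x in fx
  ... | zero  = sum-map-≤-unique u f≤m same
  ... | suc j = begin
    suc j + sum (map f xs)  ≡⟨ cong (suc j +_) (sum-map-0 rest) ⟩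
    suc j + 0               ≡⟨ +-identityʳ (suc j) ⟩
    suc j                   ≡⟨ fx ⟨
    f x                     ≤⟨ f≤m x ⟩
    m                       ∎
    where
    open ≤-Reasoning
    fx≢0 : f x ≢ 0
    fx≢0 eq with trans (≡-sym fx) eq
    ... | ()
    rest : ∀ {y} → y ∈ xs → f y ≡ 0
    rest {y} y∈ with f y in fy
    ... | zero  = refl
    ... | suc _ = contradiction (same fx≢0 (λ eq → 0≢1+n (trans (≡-sym eq) fy)))
                                (All.lookup x∉xs y∈)

sum-map-swap : ∀ {A B : Set} (f : A → B → ℕ) xs ys →
               sum (map (λ x → sum (map (f x) ys)) xs) ≡
               sum (map (λ y → sum (map (λ x → f x y) xs)) ys)
sum-map-swap f []       ys = ≡-sym (sum-map-0 {xs = ys} (λ _ → refl))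
sum-map-swap f (x ∷ xs) ys = trans (cong (sum (map (f x) ys) +_) (sum-map-swap f xs ys))
  (≡-sym (sum-map-+ (f x) (λ y → sum (map (λ x′ → f x′ y) xs)) ys))

∑ : ∀ {m} → (Fin m → ℕ) → ℕ
∑ {m} f = sum (map f (allFin m))

∑-mono : ∀ {m} {f g : Fin m → ℕ} → (∀ i → f i ≤ g i) → ∑ f ≤ ∑ g
∑-mono f≤g = sum-map-mono f≤g (allFin _)

≤∑ : ∀ {m} (f : Fin m → ℕ) i → f i ≤ ∑ f
≤∑ f i = ∈⇒≤sum-map f (∈-allFin i)

does⇒ : ∀ {P : Set} (P? : Dec P) → does P? ≡ true → P
does⇒ (yes p) _ = p

indicator-mono : ∀ {p q} → (p ≡ true → q ≡ true) → indicator p ≤ indicator q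
indicator-mono {false}         _ = z≤n
indicator-mono {true}  {true}  _ = ≤-refl
indicator-mono {true}  {false} h with h refl
... | ()

indicator-disjoint : ∀ {p q r} → (q ≡ true → p ≡ true) → (r ≡ true → p ≡ true) →
                     (q ≡ true → r ≡ true → ⊥) → indicator q + indicator r ≤ indicator p
indicator-disjoint {q = false}         _ r⇒p _ = indicator-mono r⇒p
indicator-disjoint {q = true} {false}  q⇒p _ _ = indicator-mono q⇒p
indicator-disjoint {q = true} {true}   _ _ qr  = ⊥-elim (qr refl refl)

∧-true⁻ : ∀ {p q} → p ∧ q ≡ true → p ≡ true × q ≡ true
∧-true⁻ {true} {true} _ = refl , refl

∧-true⁺ : ∀ {p q} → p ≡ true → q ≡ true → p ∧ q ≡ true
∧-true⁺ refl refl = refl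

-- A charging argument: each i passes its value to a related j, and since no j is related to two
-- different i, it is charged at most `g j`.
∑-matching : ∀ {m m′} {f : Fin m → ℕ} {g : Fin m′ → ℕ} {R : Fin m → Fin m′ → Set} →
             (∀ i j → Dec (R i j)) → (∀ {i i′ j} → R i j → R i′ j → i ≡ i′) →
             (∀ i → f i ≡ 0 ⊎ ∃[ j ] (R i j × f i ≤ g j)) → ∑ f ≤ ∑ g
∑-matching {m} {m′} {f} {g} {R} R? functional matched = begin
  ∑ f                                  ≤⟨ ∑-mono charge ⟩
  ∑ (λ i → ∑ (λ j → weight i j))       ≡⟨ sum-map-swap weight (allFin m) (allFin m′) ⟩
  ∑ (λ j → ∑ (λ i → weight i j))       ≤⟨ ∑-mono (λ j → sum-map-≤-unique (allFin⁺ m) (weight≤ j) (same j)) ⟩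
  ∑ g                                  ∎
  where
  open ≤-Reasoning
  weight : Fin m → Fin m′ → ℕ
  weight i j = indicator (does (R? i j)) * g j
  charge : ∀ i → f i ≤ ∑ (weight i)
  charge i with matched i
  ... | inj₁ fi≡0            = ≤-trans (≤-reflexive fi≡0) z≤n
  ... | inj₂ (j , Rij , f≤g) = ≤-trans
    (≤-trans f≤g (≤-reflexive (≡-sym (trans
      (cong (λ b → indicator b * g j) (dec-true (R? i j) Rij)) (*-identityˡ (g j))))))
    (≤∑ (weight i) j)
  weight≤ : ∀ j i → weight i j ≤ g j
  weight≤ j i with does (R? i j)
  ... | true  = ≤-reflexive (*-identityˡ (g j))
  ... | false = z≤n
  related : ∀ i j → weight i j ≢ 0 → R i j
  related i j w≢0 with R? i j
  ... | yes Rij = Rij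
  ... | no  _   = contradiction refl w≢0
  same : ∀ j {i i′} → weight i j ≢ 0 → weight i′ j ≢ 0 → i ≡ i′
  same j {i} {i′} w w′ = functional (related i j w) (related i′ j w′)

-- Everything is counted over ordered pairs, where no index order has to be respected;
-- for a set of edges this is twice the number of edges (pairs≡2*edges).
pairs : ∀ {m} → (Fin m → Fin m → Bool) → ℕ
pairs P = ∑ (λ i → ∑ (λ j → indicator (P i j)))

edges : ∀ {m} → (Fin m → Fin m → Bool) → ℕ
edges P = ∑ (λ i → ∑ (λ j → indicator ((toℕ i <ᵇ toℕ j) ∧ P i j)))

∑∑-+ : ∀ {m} (f g : Fin m → Fin m → ℕ) →
       ∑ (λ i → ∑ (λ j → f i j + g i j)) ≡ ∑ (λ i → ∑ (f i)) + ∑ (λ i → ∑ (g i))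
∑∑-+ {m} f g = ≤-antisym
  (≤-trans (∑-mono (λ i → ≤-reflexive (inner i))) (≤-reflexive outer))
  (≤-trans (≤-reflexive (≡-sym outer)) (∑-mono (λ i → ≤-reflexive (≡-sym (inner i)))))
  where
  inner : ∀ i → ∑ (λ j → f i j + g i j) ≡ ∑ (f i) + ∑ (g i)
  inner i = sum-map-+ (f i) (g i) (allFin m)
  outer : ∑ (λ i → ∑ (f i) + ∑ (g i)) ≡ ∑ (λ i → ∑ (f i)) + ∑ (λ i → ∑ (g i))
  outer = sum-map-+ (λ i → ∑ (f i)) (λ i → ∑ (g i)) (allFin m)

∑∑-mono : ∀ {m} {f g : Fin m → Fin m → ℕ} → (∀ i j → f i j ≤ g i j) →
          ∑ (λ i → ∑ (f i)) ≤ ∑ (λ i → ∑ (g i))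
∑∑-mono f≤g = ∑-mono (λ i → ∑-mono (f≤g i))

∑∑-cong : ∀ {m} {f g : Fin m → Fin m → ℕ} → (∀ i j → f i j ≡ g i j) →
          ∑ (λ i → ∑ (f i)) ≡ ∑ (λ i → ∑ (g i))
∑∑-cong f≡g = ≤-antisym (∑∑-mono (λ i j → ≤-reflexive (f≡g i j)))
                        (∑∑-mono (λ i j → ≤-reflexive (≡-sym (f≡g i j))))

pairs≡2*edges : ∀ {m} (P : Fin m → Fin m → Bool) → (∀ i j → P i j ≡ P j i) →
                (∀ i → P i i ≡ false) → pairs P ≡ 2 * edges P
pairs≡2*edges {m} P P-sym P-irrefl = begin-equality
  pairs P
    ≡⟨ ∑∑-cong split ⟩
  ∑ (λ i → ∑ (λ j → below i j + below j i))
    ≡⟨ ∑∑-+ below (λ i j → below j i) ⟩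
  edges P + ∑ (λ i → ∑ (λ j → below j i))
    ≡⟨ cong (edges P +_) (sum-map-swap (λ i j → below j i) (allFin m) (allFin m)) ⟩
  edges P + edges P
    ≡⟨ cong (edges P +_) (≡-sym (+-identityʳ (edges P))) ⟩
  2 * edges P ∎
  where
  open ≤-Reasoning
  below : Fin m → Fin m → ℕ
  below i j = indicator ((toℕ i <ᵇ toℕ j) ∧ P i j)
  <⇒<ᵇ≡ : ∀ {x y} → x < y → (x <ᵇ y) ≡ true
  <⇒<ᵇ≡ {x} {y} = dec-true (x <? y)
  ≥⇒<ᵇ≡ : ∀ {x y} → y ≤ x → (x <ᵇ y) ≡ false
  ≥⇒<ᵇ≡ {x} {y} y≤x = dec-false (x <? y) (≤⇒≯ y≤x)
  split : ∀ i j → indicator (P i j) ≡ below i j + below j i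
  split i j with <-cmp (toℕ i) (toℕ j)
  ... | tri< i<j _ _ rewrite <⇒<ᵇ≡ i<j | ≥⇒<ᵇ≡ (<⇒≤ i<j) = ≡-sym (+-identityʳ _)
  ... | tri> _ _ j<i rewrite <⇒<ᵇ≡ j<i | ≥⇒<ᵇ≡ (<⇒≤ j<i) = cong indicator (P-sym i j)
  ... | tri≈ _ i≡j _ with toℕ-injective i≡j
  ...   | refl rewrite ≥⇒<ᵇ≡ (≤-refl {toℕ i}) = cong indicator (P-irrefl i)

-- `∑-matching` is applied twice, to the rows and then within each row. Only indices that occur in
-- some pair need a partner; any other row sums to zero.
pairs-matching : ∀ {m m′} {P : Fin m → Fin m → Bool} {Q : Fin m′ → Fin m′ → Bool}
                 {R : Fin m → Fin m′ → Set} →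
                 (∀ i j → Dec (R i j)) → (∀ {i i′ j} → R i j → R i′ j → i ≡ i′) →
                 (∀ i i′ → P i i′ ≡ true → ∃[ j ] ∃[ j′ ] (R i j × R i′ j′)) →
                 (∀ {i i′ j j′} → R i j → R i′ j′ → P i i′ ≡ true → Q j j′ ≡ true) →
                 pairs P ≤ pairs Q
pairs-matching {m} {m′} {P} {Q} {R} R? functional matched P⇒Q =
  ∑-matching R? functional outer
  where
  outer : ∀ i → ∑ (λ i′ → indicator (P i i′)) ≡ 0 ⊎
          ∃[ j ] (R i j × ∑ (λ i′ → indicator (P i i′)) ≤ ∑ (λ j′ → indicator (Q j j′)))
  outer i with any? (R? i)
  ... | yes (j , Rij) = inj₂ (j , Rij , ∑-matching R? functional inner)
    where
    inner : ∀ i′ → indicator (P i i′) ≡ 0 ⊎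
            ∃[ j′ ] (R i′ j′ × indicator (P i i′) ≤ indicator (Q j j′))
    inner i′ with P i i′ in p
    ... | false = inj₁ refl
    ... | true with matched i i′ p
    ...   | _ , j′ , _ , Rij′ = inj₂ (j′ , Rij′ , indicator-mono (λ _ → P⇒Q Rij Rij′ p))
  ... | no ¬R = inj₁ (sum-map-0 {xs = allFin m} (λ {i′} _ → zero-row i′))
    where
    zero-row : ∀ i′ → indicator (P i i′) ≡ 0
    zero-row i′ with P i i′ in p
    ... | false = refl
    ... | true with matched i i′ p
    ...   | j , _ , Rij , _ = contradiction (j , Rij) ¬R

-- Walks, balls and induced copies

Vertex : Graph → Set
Vertex G = Fin (n G)

Walk-map : ∀ {G H} (f : Vertex H → Vertex G) →
           (∀ {x y} → adj H x y ≡ true → adj G (f x) (f y) ≡ true) →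
           ∀ {x y ℓ} → Walk H x y ℓ → Walk G (f x) (f y) ℓ
Walk-map f f-adj nil        = nil
Walk-map f f-adj (cons e w) = cons (f-adj e) (Walk-map f f-adj w)

Walk-++ : ∀ {G} {u v w : Vertex G} {ℓ ℓ′} → Walk G u v ℓ → Walk G v w ℓ′ → Walk G u w (ℓ + ℓ′)
Walk-++ nil        q = q
Walk-++ (cons e p) q = cons e (Walk-++ p q)

Walk-reverse : ∀ {G} {u v : Vertex G} {ℓ} → Walk G u v ℓ → Walk G v u ℓ
Walk-reverse     nil                       = nil
Walk-reverse {G} (cons {u} {w} {ℓ = ℓ} e p) = subst (Walk G _ _) (+-comm ℓ 1)
  (Walk-++ (Walk-reverse p) (cons (trans (sym G w u) e) nil))

Walk? : ∀ G (u v : Vertex G) ℓ → Dec (Walk G u v ℓ)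
Walk? G u v zero    = map′ (λ { refl → nil }) (λ { nil → refl }) (u ≟ v)
Walk? G u v (suc ℓ) = map′ (λ (_ , e , p) → cons e p) (λ { (cons e p) → _ , e , p })
  (any? (λ w → (adj G u w Bool.≟ true) ×-dec Walk? G w v ℓ))

DistLe? : ∀ G u v t → Dec (DistLe G u v t)
DistLe? G u v t = map′ (λ (ℓ , ℓ<1+t , w) → ℓ , ≤-pred ℓ<1+t , w) (λ (ℓ , ℓ≤t , w) → ℓ , s≤s ℓ≤t , w)
  (anyUpTo? (Walk? G u v) (suc t))

length-concatMap : ∀ {A B : Set} (f : A → List B) xs →
                   length (concatMap f xs) ≡ sum (map (length ∘ f) xs)
length-concatMap f []       = refl
length-concatMap f (x ∷ xs) =
  trans (length-++ (f x)) (cong (length (f x) +_) (length-concatMap f xs))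

length-concatMap-≤ : ∀ {A B : Set} (f : A → List B) {m} → (∀ x → length (f x) ≤ m) →
                     ∀ xs → length (concatMap f xs) ≤ length xs * m
length-concatMap-≤ f         f≤m []       = z≤n
length-concatMap-≤ f {m = m} f≤m (x ∷ xs) = begin
  length (concatMap f (x ∷ xs))           ≡⟨ length-++ (f x) ⟩
  length (f x) + length (concatMap f xs)  ≤⟨ +-mono-≤ (f≤m x) (length-concatMap-≤ f f≤m xs) ⟩
  m + length xs * m                       ∎
  where open ≤-Reasoning

length-filter-sum : ∀ {A : Set} (b : A → Bool) xs →
                    length (filter (λ x → b x Bool.≟ true) xs) ≡ sum (map (indicator ∘ b) xs)
length-filter-sum b []       = refl
length-filter-sum b (x ∷ xs) with b x
... | true  = cong suc (length-filter-sum b xs)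
... | false = length-filter-sum b xs

-- Pigeonhole: i goes to a position of `f i` in the list, and looking that position up recovers
-- `f i`.
covering-length : ∀ {m} {A : Set} {f : Fin m → A} (xs : List A) → Injective _≡_ _≡_ f →
                  (∀ i → f i ∈ xs) → m ≤ length xs
covering-length {f = f} xs f-injective f∈xs = injective⇒≤ {f = λ i → Any.index (f∈xs i)}
  λ {i} {j} eq → f-injective (trans (lookup-index (f∈xs i))
    (trans (cong (lookup xs) eq) (≡-sym (lookup-index (f∈xs j)))))

neighbours : ∀ G → Vertex G → List (Vertex G)
neighbours G v = filter (λ w → adj G v w Bool.≟ true) (allFin (n G))

-- A list with repetitions, one entry for each walk of length at most r from v. No distances have to
-- be computed, and the length obeys a simple recursion.
ball : ∀ G → ℕ → Vertex G → List (Vertex G)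
ball G zero    v = v ∷ []
ball G (suc r) v = v ∷ concatMap (ball G r) (neighbours G v)

Walk⇒∈ball : ∀ {G u v ℓ r} → Walk G u v ℓ → ℓ ≤ r → v ∈ ball G r u
Walk⇒∈ball {r = zero}      nil        _         = here refl
Walk⇒∈ball {r = suc r}     nil        _         = here refl
Walk⇒∈ball {G} {r = suc r} (cons e p) (s≤s ℓ≤r) = there (∈-concatMap⁺ (ball G r)
  (lose (∈-filter⁺ (λ w → adj G _ w Bool.≟ true) (∈-allFin _) e) (Walk⇒∈ball p ℓ≤r)))

-- Strictness makes the induction close: a centre and at most Δ lists of at most Δ^(r+1) - 1 entries
-- give 1 + Δ (Δ^(r+1) - 1) entries, which is below Δ^(r+2) because 1 < Δ.
length-ball : ∀ {G Δ} → 2 ≤ Δ → MaxDegreeLe G Δ → ∀ r v → length (ball G r v) < Δ ^ suc r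
length-ball {Δ = Δ} 2≤Δ _ zero v = subst (1 <_) (≡-sym (^-identityʳ Δ)) 2≤Δ
length-ball {G} {Δ} 2≤Δ deg≤Δ (suc r) v = begin
  2 + length (concatMap (ball G r) (neighbours G v))
    ≤⟨ +-mono-≤ 2≤Δ (length-concatMap-≤ (ball G r) {pred (Δ ^ suc r)}
         (λ w → <⇒≤pred (length-ball 2≤Δ deg≤Δ r w)) (neighbours G v)) ⟩
  Δ + length (neighbours G v) * pred (Δ ^ suc r)
    ≡⟨ cong (λ m → Δ + m * pred (Δ ^ suc r)) (length-filter-sum (adj G v) (allFin (n G))) ⟩
  Δ + degree G v * pred (Δ ^ suc r)
    ≤⟨ +-monoʳ-≤ Δ (*-monoˡ-≤ (pred (Δ ^ suc r)) (deg≤Δ v)) ⟩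
  Δ + Δ * pred (Δ ^ suc r)
    ≡⟨ *-suc Δ (pred (Δ ^ suc r)) ⟨
  Δ * suc (pred (Δ ^ suc r))
    ≡⟨ cong (Δ *_) (suc-pred (Δ ^ suc r) {{m^n≢0 Δ (suc r) {{>-nonZero (<⇒≤ 2≤Δ)}}}}) ⟩
  Δ ^ suc (suc r) ∎
  where open ≤-Reasoning

-- Decidability of membership in V_ℋ

Vec-any? : ∀ {m k} {P : Vec (Fin k) m → Set} → (∀ xs → Dec (P xs)) → Dec (∃ P)
Vec-any? {zero}  P? = map′ (Vec.[] ,_) (λ { (Vec.[] , p) → p }) (P? Vec.[])
Vec-any? {suc m} P? = map′ (λ (x , xs , p) → x Vec.∷ xs , p) (λ { (x Vec.∷ xs , p) → x , xs , p })
  (any? (λ x → Vec-any? (λ xs → P? (x Vec.∷ xs))))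

CopyThrough : (H G : Graph) → Vertex G → Set
CopyThrough H G v = Σ (InducedEmbedding H G) λ e → ∃[ i ] (proj₁ e i ≡ v)

-- Vertex maps are searched for as vectors, which can be enumerated. A map and its table agree
-- pointwise, and each condition depends only on the values.
CopyThrough? : ∀ H G v → Dec (CopyThrough H G v)
CopyThrough? H G v = map′
  (λ (xs , injective , agrees , hit) →
     (Vec.lookup xs , (λ {i} {j} → injective i j) , agrees) , hit)
  (λ ((f , injective , agrees) , i , fi≡v) →
     let f≗ = lookup∘tabulate f in
     Vec.tabulate f ,
     (λ i j eq → injective (trans (≡-sym (f≗ i)) (trans eq (f≗ j)))) ,
     (λ i j → trans (agrees i j) (≡-sym (cong₂ (adj G) (f≗ i) (f≗ j)))) ,
     i , trans (f≗ i) fi≡v)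
  (Vec-any? λ xs →
    all? (λ i → all? (λ j → (Vec.lookup xs i ≟ Vec.lookup xs j) →-dec (i ≟ j))) ×-dec
    (all? (λ i → all? (λ j → adj H i j Bool.≟ adj G (Vec.lookup xs i) (Vec.lookup xs j))) ×-dec
    any? (λ i → Vec.lookup xs i ≟ v)))

InVH? : ∀ ℋ G v → Dec (InVH ℋ G v)
InVH? ℋ G v = map′ find (λ (_ , H∈ℋ , copy) → lose H∈ℋ copy)
  (Any.any? (λ H → CopyThrough? H G v) ℋ)

InducedEmbedding-∘ : ∀ {H G G′} → InducedEmbedding H G → InducedEmbedding G G′ →
                     InducedEmbedding H G′
InducedEmbedding-∘ (f , f-injective , f-adj) (g , g-injective , g-adj) =
  g ∘ f , f-injective ∘ g-injective , λ i j → trans (f-adj i j) (g-adj (f i) (f j))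

InVH-embedding : ∀ {ℋ G G′} ((g , _) : InducedEmbedding G G′) {v} →
                 InVH ℋ G v → InVH ℋ G′ (g v)
InVH-embedding {G = G} {G′} e (H , H∈ℋ , copy , i , refl) =
  H , H∈ℋ , InducedEmbedding-∘ {H} {G} {G′} copy e , i , refl

-- Deletions and the copies they destroy or create

Deleted : ∀ {G} → Deletion G → Vertex G → Vertex G → Set
Deleted {G} F u v = adj G u v ≡ true × adj' F u v ≡ false

DeletedPairIn : ∀ {G} → Deletion G → ∀ {m} → (Fin m → Vertex G) → Set
DeletedPairIn F f = ∃[ x ] ∃[ y ] Deleted F (f x) (f y)

-- A deletion adds no edge, so the two graphs can differ on the image of `f` only by a deleted edge.
agree-or-deleted : ∀ {G} (F : Deletion G) {m} (f : Fin m → Vertex G) →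
                   (∀ x y → adj G (f x) (f y) ≡ adj' F (f x) (f y)) ⊎ DeletedPairIn F f
agree-or-deleted {G} F f
  with any? (λ x → any? (λ y → (adj G (f x) (f y) Bool.≟ true) ×-dec (adj' F (f x) (f y) Bool.≟ false)))
... | yes deleted = inj₂ deleted
... | no ¬deleted = inj₁ agree
  where
  agree : ∀ x y → adj G (f x) (f y) ≡ adj' F (f x) (f y)
  agree x y with adj G (f x) (f y) in before | adj' F (f x) (f y) in after
  ... | true  | true  = refl
  ... | false | false = refl
  ... | true  | false = contradiction (x , y , before , after) ¬deleted
  ... | false | true  with trans (≡-sym before) (sub' F _ _ after)
  ...   | ()

copy-hits-solution : ∀ {ℋ G} (F : Deletion G) → HFree ℋ (result G F) → ∀ {H} → H ∈ ℋ →
                     ((f , _) : InducedEmbedding H G) → DeletedPairIn F f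
copy-hits-solution F free H∈ℋ (f , injective , f-adj) with agree-or-deleted F f
... | inj₁ agree = contradiction
    (f , (λ {x} {y} → injective {x} {y}) , λ x y → trans (f-adj x y) (agree x y)) (free _ H∈ℋ)
... | inj₂ hit   = hit

-- For `H` in ℋ, the first case places the copy in V_ℋ, and the second locates it around a deleted
-- edge by its diameter. Both the descent and the lifting of solutions to G rest on this split.
copy-original-or-created : ∀ {G} (F : Deletion G) {H} ((f , _) : InducedEmbedding H (result G F)) →
                           (∀ x y → adj H x y ≡ adj G (f x) (f y)) ⊎ DeletedPairIn F f
copy-original-or-created F (f , _ , f-adj) with agree-or-deleted F f
... | inj₁ agree = inj₁ (λ x y → trans (f-adj x y) (≡-sym (agree x y)))
... | inj₂ hit   = inj₂ hit

missing : ∀ G → Deletion G → ℕ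
missing G F = pairs (λ u v → adj G u v ∧ not (adj' F u v))

missing≡2*deletedCount : ∀ G F → missing G F ≡ 2 * deletedCount G F
missing≡2*deletedCount G F = pairs≡2*edges _
  (λ u v → cong₂ (λ p q → p ∧ not q) (sym G u v) (sym' F u v))
  (λ u → cong (_∧ not (adj' F u u)) (irrefl G u))

Deleted⇒ : ∀ {G} (F : Deletion G) {u v} → Deleted F u v → adj G u v ∧ not (adj' F u v) ≡ true
Deleted⇒ F (before , after) = ∧-true⁺ before (cong not after)

⇒Deleted : ∀ {G} (F : Deletion G) {u v} → adj G u v ∧ not (adj' F u v) ≡ true → Deleted F u v
⇒Deleted F eq with ∧-true⁻ eq
... | before , after = before , trans (≡-sym (Bool.not-involutive _)) (cong not after)

-- Replacing a solution by a cheaper one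

cut : ∀ G {P : Vertex G → Vertex G → Set} → (∀ u v → Dec (P u v)) →
      (∀ {u v} → P u v → P v u) → Deletion G
cut G P? P-sym = record
  { adj'    = λ u v → adj G u v ∧ does (P? u v)
  ; sym'    = λ u v → cong₂ _∧_ (sym G u v) (does-⇔ (mk⇔ P-sym P-sym) (P? u v) (P? v u))
  ; irrefl' = λ u → cong (_∧ does (P? u u)) (irrefl G u)
  ; sub'    = λ u v → proj₁ ∘ ∧-true⁻
  }

cut-deletes : ∀ G {P : Vertex G → Vertex G → Set} (P? : ∀ u v → Dec (P u v))
              (P-sym : ∀ {u v} → P u v → P v u) {u v} →
              Deleted (cut G {P} P? P-sym) u v → adj G u v ≡ true × ¬ P u v
cut-deletes G P? P-sym {u} {v} (before , after) = before , λ p →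
  contradiction (trans (≡-sym (∧-true⁺ before (dec-true (P? u v) p))) after) λ ()

module _ {G : Graph} (F : Deletion G) where

  Restored : (S : Vertex G → Set) → Vertex G → Vertex G → Set
  Restored S u v = Deleted F u v × ¬ (S u × S v)

  Restored-sym : ∀ S {u v} → Restored S u v → Restored S v u
  Restored-sym S {u} {v} ((before , after) , ¬S) =
    (trans (sym G v u) before , trans (sym' F v u) after) , λ (Sv , Su) → ¬S (Su , Sv)

  Restored? : ∀ {S} → (∀ u → Dec (S u)) → ∀ u v → Dec (Restored S u v)
  Restored? S? u v = ((adj G u v Bool.≟ true) ×-dec (adj' F u v Bool.≟ false)) ×-dec
                     ¬? (S? u ×-dec S? v)

  restored : ∀ {S} → (∀ u → Dec (S u)) → ℕ
  restored {S} S? = pairs (λ u v → does (Restored? {S} S? u v))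

-- The solution F is only trusted inside S: the deleted edges outside S are restored, and
-- instead all edges at the endpoints of those restored edges that lie in S⁺ are deleted.
module Reroute {G : Graph} (F : Deletion G) {S S⁺ : Vertex G → Set}
               (S? : ∀ u → Dec (S u)) (S⁺? : ∀ u → Dec (S⁺ u)) where

  Kept-edge : Vertex G → Vertex G → Set
  Kept-edge u v = adj' F u v ≡ true ⊎ ¬ (S u × S v)

  Kept-edge? : ∀ u v → Dec (Kept-edge u v)
  Kept-edge? u v = (adj' F u v Bool.≟ true) ⊎-dec ¬? (S? u ×-dec S? v)

  Kept-edge-sym : ∀ {u v} → Kept-edge u v → Kept-edge v u
  Kept-edge-sym {u} {v} (inj₁ e)  = inj₁ (trans (sym' F v u) e)
  Kept-edge-sym         (inj₂ ¬S) = inj₂ (λ (Sv , Su) → ¬S (Su , Sv))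

  keep : Deletion G
  keep = cut G Kept-edge? Kept-edge-sym

  Frontier : Vertex G → Vertex G → Set
  Frontier u v = Restored F S u v × (S⁺ u × S⁺ v)

  Frontier? : ∀ u v → Dec (Frontier u v)
  Frontier? u v = Restored? F {S} S? u v ×-dec (S⁺? u ×-dec S⁺? v)

  Touched : Vertex G → Set
  Touched u = ∃ (Frontier u)

  Touched? : ∀ u → Dec (Touched u)
  Touched? u = any? (Frontier? u)

  Rerouted-edge? : ∀ u v → Dec (Kept-edge u v × ¬ Touched u × ¬ Touched v)
  Rerouted-edge? u v = Kept-edge? u v ×-dec (¬? (Touched? u) ×-dec ¬? (Touched? v))

  reroute : Deletion G
  reroute = cut G Rerouted-edge? (λ (kept , ¬u , ¬v) → Kept-edge-sym kept , ¬v , ¬u)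

  frontier : ℕ
  frontier = pairs (λ u v → does (Frontier? u v))

  keep-deletes : ∀ {u v} → Deleted keep u v → Deleted F u v × S u × S v
  keep-deletes {u} {v} deleted with cut-deletes G Kept-edge? Kept-edge-sym deleted
  ... | before , ¬kept = (before , Bool.¬-not (¬kept ∘ inj₁)) ,
                         decidable-stable (S? u ×-dec S? v) (¬kept ∘ inj₂)

  module _ {ℋ : List Graph} (connected : ∀ {H} → H ∈ ℋ → Connected H)
           (free : HFree ℋ (result G F))
           (copies-in-S⁺ : ∀ {H} → H ∈ ℋ → ((f , _) : InducedEmbedding H (result G keep)) →
                           ∀ x → S⁺ (f x)) where

    private
      -- `keep` only deletes edges that `F` deletes, so `F` can also be read as a deletion in the
      -- intermediate graph, with the same final graph.
      solution-of-keep : Deletion (result G keep)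
      solution-of-keep = record
        { adj' = adj' F ; sym' = sym' F ; irrefl' = irrefl' F
        ; sub' = λ u v e → ∧-true⁺ (sub' F u v e) (dec-true (Kept-edge? u v) (inj₁ e)) }

    -- Touched vertices are isolated, so a connected copy through one is a single vertex,
    -- which F would also leave behind; a copy avoiding them is a copy in keep, where F
    -- must delete one of its edges, and that edge is on the frontier.
    reroute-free : HFree ℋ (result G reroute)
    reroute-free H H∈ℋ (f , injective , f-adj) with any? (Touched? ∘ f)
    ... | yes (x , touched) = free H H∈ℋ (f , (λ {y} {z} → injective {y} {z}) , agrees)
      where
      only-x : ∀ y → x ≡ y
      only-x y with connected H∈ℋ x y
      ... | _ , nil             = refl
      ... | _ , cons {w = w} e _ =
        contradiction touched (proj₁ (proj₂ (does⇒ (Rerouted-edge? (f x) (f w))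
          (proj₂ (∧-true⁻ {adj G (f x) (f w)} (trans (≡-sym (f-adj x w)) e))))))
      agrees : ∀ y z → adj H y z ≡ adj' F (f y) (f z)
      agrees y z with only-x y | only-x z
      ... | refl | refl = trans (irrefl H y) (≡-sym (irrefl' F (f y)))
    ... | no ¬touched = meets (copy-hits-solution {ℋ} solution-of-keep free H∈ℋ copy)
      where
      copy : InducedEmbedding H (result G keep)
      copy = f , (λ {y} {z} → injective {y} {z}) , λ y z → trans (f-adj y z)
        (cong (adj G (f y) (f z) ∧_) (does-⇔
          (mk⇔ proj₁ (λ kept → kept , (λ t → ¬touched (y , t)) , λ t → ¬touched (z , t)))
          (Rerouted-edge? (f y) (f z)) (Kept-edge? (f y) (f z))))
      meets : ¬ DeletedPairIn solution-of-keep f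
      meets (x , y , kept , after) with ∧-true⁻ kept
      ... | before , d with does⇒ (Kept-edge? (f x) (f y)) d
      ...   | inj₁ e  = contradiction (trans (≡-sym e) after) λ ()
      ...   | inj₂ ¬S = ¬touched (x , f y , ((before , after) , ¬S) ,
                                  copies-in-S⁺ H∈ℋ copy x , copies-in-S⁺ H∈ℋ copy y)

  -- Pairs deleted by `keep` have both ends in `S` and restored pairs do not, so they are disjoint
  -- parts of what `F` deletes.
  missing-keep : missing G keep + restored F {S} S? ≤ missing G F
  missing-keep = ≤-trans
    (≤-reflexive (≡-sym (∑∑-+ (λ u v → indicator (adj G u v ∧ not (adj' keep u v)))
                                (λ u v → indicator (does (Restored? F {S} S? u v))))))
    (∑∑-mono λ u v → indicator-disjoint
      (Deleted⇒ F ∘ proj₁ ∘ keep-deletes ∘ ⇒Deleted keep)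
      (Deleted⇒ F ∘ proj₁ ∘ does⇒ (Restored? F {S} S? u v))
      (λ gone back → proj₂ (does⇒ (Restored? F {S} S? u v) back)
                           (proj₂ (keep-deletes (⇒Deleted keep gone)))))

  -- This is r_(j+1) + t_j ≤ r_j: frontier pairs have both ends in `S⁺`, pairs still restored for
  -- `S⁺` do not, and both kinds are restored for `S`.
  restored-frontier : (∀ {u} → S u → S⁺ u) →
                      restored F {S⁺} S⁺? + frontier ≤ restored F {S} S?
  restored-frontier S⇒S⁺ = ≤-trans
    (≤-reflexive (≡-sym (∑∑-+ (λ u v → indicator (does (Restored? F {S⁺} S⁺? u v)))
                                (λ u v → indicator (does (Frontier? u v))))))
    (∑∑-mono λ u v → indicator-disjoint
      (λ d → dec-true (Restored? F {S} S? u v) (let (del , ¬S⁺) = does⇒ (Restored? F {S⁺} S⁺? u v) d in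
         del , λ (Su , Sv) → ¬S⁺ (S⇒S⁺ Su , S⇒S⁺ Sv)))
      (λ d → dec-true (Restored? F {S} S? u v) (proj₁ (does⇒ (Frontier? u v) d)))
      (λ d d′ → proj₂ (does⇒ (Restored? F {S⁺} S⁺? u v) d) (proj₂ (does⇒ (Frontier? u v) d′))))

  -- Each newly deleted pair is charged to a touched end. A touched vertex has at most Δ edges and
  -- starts at least one frontier pair, so each of the two ends accounts for at most Δ times
  -- `frontier`.
  missing-reroute : ∀ {Δ} → MaxDegreeLe G Δ →
                    missing G reroute ≤ missing G keep + 2 * Δ * frontier
  missing-reroute {Δ} deg≤Δ = begin
    missing G reroute
      ≤⟨ ∑∑-mono charge ⟩
    ∑ (λ u → ∑ (λ v → gone u v + (at u v + at v u)))
      ≡⟨ ∑∑-+ gone (λ u v → at u v + at v u) ⟩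
    missing G keep + ∑ (λ u → ∑ (λ v → at u v + at v u))
      ≡⟨ cong (missing G keep +_) (∑∑-+ at (λ u v → at v u)) ⟩
    missing G keep + (∑ (λ u → ∑ (at u)) + ∑ (λ u → ∑ (λ v → at v u)))
      ≡⟨ cong (λ m → missing G keep + (∑ (λ u → ∑ (at u)) + m))
           (sum-map-swap (λ u v → at v u) (allFin (n G)) (allFin (n G))) ⟩
    missing G keep + (∑ (λ u → ∑ (at u)) + ∑ (λ u → ∑ (at u)))
      ≤⟨ +-monoʳ-≤ (missing G keep) (+-mono-≤ total total) ⟩
    missing G keep + (Δ * frontier + Δ * frontier)
      ≡⟨ cong (missing G keep +_) (double Δ frontier) ⟩
    missing G keep + 2 * Δ * frontier ∎
    where
    open ≤-Reasoning
    double : ∀ x y → x * y + x * y ≡ 2 * x * y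
    double = solve-∀
    gone at : Vertex G → Vertex G → ℕ
    gone u v = indicator (adj G u v ∧ not (adj' keep u v))
    at u v = indicator (adj G u v ∧ does (Touched? u))
    -- The bits say: edge of G, edge left by `keep`, first end touched, second end touched.
    charge-bits : ∀ e k p q → indicator (e ∧ not (e ∧ (k ∧ (not p ∧ not q)))) ≤
                  indicator (e ∧ not (e ∧ k)) + (indicator (e ∧ p) + indicator (e ∧ q))
    charge-bits false _     _     _     = z≤n
    charge-bits true  false _     _     = s≤s z≤n
    charge-bits true  true  true  _     = s≤s z≤n
    charge-bits true  true  false true  = s≤s z≤n
    charge-bits true  true  false false = z≤n
    charge : ∀ u v → indicator (adj G u v ∧ not (adj' reroute u v)) ≤ gone u v + (at u v + at v u)
    charge u v rewrite sym G v u =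
      charge-bits (adj G u v) (does (Kept-edge? u v)) (does (Touched? u)) (does (Touched? v))
    row : ∀ u → ∑ (at u) ≤ Δ * ∑ (λ v → indicator (does (Frontier? u v)))
    row u with Touched? u
    ... | no _ = ≤-trans (≤-reflexive (sum-map-0 {xs = allFin (n G)} λ {v} _ →
                   cong indicator (Bool.∧-zeroʳ (adj G u v)))) z≤n
    ... | yes (w , front) = begin
      ∑ (λ v → indicator (adj G u v ∧ true))
        ≤⟨ ∑-mono (λ v → indicator-mono (proj₁ ∘ ∧-true⁻ {adj G u v})) ⟩
      degree G u
        ≤⟨ deg≤Δ u ⟩
      Δ
        ≡⟨ *-identityʳ Δ ⟨
      Δ * 1
        ≡⟨ cong (λ b → Δ * indicator b) (≡-sym (dec-true (Frontier? u w) front)) ⟩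
      Δ * indicator (does (Frontier? u w))
        ≤⟨ *-monoʳ-≤ Δ (≤∑ (λ v → indicator (does (Frontier? u v))) w) ⟩
      Δ * ∑ (λ v → indicator (does (Frontier? u v))) ∎
    total : ∑ (λ u → ∑ (at u)) ≤ Δ * frontier
    total = ≤-trans (∑-mono row) (≤-reflexive (sum-map-*ˡ Δ _ (allFin (n G))))

-- Locality of cheap solutions

≤pairs : ∀ {m} (P : Fin m → Fin m → Bool) {u v} → P u v ≡ true → 1 ≤ pairs P
≤pairs P {u} {v} Puv = begin
  1                              ≡⟨ cong indicator (≡-sym Puv) ⟩
  indicator (P u v)              ≤⟨ ≤∑ (λ v → indicator (P u v)) v ⟩
  ∑ (λ v → indicator (P u v))    ≤⟨ ≤∑ (λ u → ∑ (λ v → indicator (P u v))) u ⟩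
  pairs P                        ∎
  where open ≤-Reasoning

Near : List Graph → (G : Graph) → ℕ → Vertex G → Set
Near ℋ G d v = ∃[ u ] (InVH ℋ G u × DistLe G v u d)

Near? : ∀ ℋ G d v → Dec (Near ℋ G d v)
Near? ℋ G d v = any? (λ u → InVH? ℋ G u ×-dec DistLe? G v u d)

Near-mono : ∀ {ℋ G d d′ v} → d ≤ d′ → Near ℋ G d v → Near ℋ G d′ v
Near-mono d≤d′ (u , u∈ , ℓ , ℓ≤d , w) = u , u∈ , ℓ , ≤-trans ℓ≤d d≤d′ , w

Near-walk : ∀ {ℋ G d e ℓ u v} → Near ℋ G d u → ℓ ≤ e → Walk G v u ℓ → Near ℋ G (e + d) v
Near-walk (u′ , u′∈ , ℓ′ , ℓ′≤d , w′) ℓ≤e w = u′ , u′∈ , _ , +-mono-≤ ℓ≤e ℓ′≤d , Walk-++ w w′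

module Descent {ℋ : List Graph} (connected : ∀ {H} → H ∈ ℋ → Connected H)
               {D : ℕ} (diameter : ∀ {H} → H ∈ ℋ → ∀ x y → DistLe H x y D)
               {G : Graph} {Δ : ℕ} (deg≤Δ : MaxDegreeLe G Δ) where

  -- The index is shifted by one: stage 0 trusts `F` nowhere, and `Shell (suc j)` is the ball of
  -- radius jD around V_ℋ.
  Shell : ℕ → Vertex G → Set
  Shell zero    v = ⊥
  Shell (suc j) v = Near ℋ G (j * D) v

  Shell? : ∀ j v → Dec (Shell j v)
  Shell? zero    v = no id
  Shell? (suc j) v = Near? ℋ G (j * D) v

  Shell-suc : ∀ j {v} → Shell j v → Shell (suc j) v
  Shell-suc (suc j) = Near-mono {ℋ} {G} (m≤n+m (j * D) D)

  module Stage (F : Deletion G) (j : ℕ) =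
    Reroute F {Shell j} {Shell (suc j)} (Shell? j) (Shell? (suc j))

  -- An original copy lies in V_ℋ itself. A created one contains an edge deleted by `keep`, whose
  -- ends are in `Shell j`, and its other vertices are at most D away.
  copies-in-shell : ∀ F j {H} → H ∈ ℋ → ((f , _) : InducedEmbedding H (result G (Stage.keep F j))) →
                    ∀ x → Shell (suc j) (f x)
  copies-in-shell F j {H} H∈ℋ copy@(f , injective , f-adj) z
    with copy-original-or-created (Stage.keep F j) {H} copy
  ... | inj₁ agree =
    f z , (H , H∈ℋ , (f , (λ {x} {y} → injective {x} {y}) , agree) , z , refl) , 0 , z≤n , nil
  ... | inj₂ (x , y , deleted) with proj₁ (proj₂ (Stage.keep-deletes F j deleted)) | diameter H∈ℋ z x
  ...   | in-shell | ℓ , ℓ≤D , w = step j in-shell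
    where
    walk : Walk G (f z) (f x) ℓ
    walk = Walk-map f (λ {a} {b} e → proj₁ (∧-true⁻ (trans (≡-sym (f-adj a b)) e))) w
    step : ∀ j → Shell j (f x) → Shell (suc j) (f z)
    -- `Shell 0` is empty, so stage 0 creates no copies and this case suffices.
    step (suc j) near = Near-walk {ℋ} {G} near ℓ≤D walk

  -- Stands in for minimality: `F` is compared only with its own reroutings, at finitely many
  -- stages. By `rest-exhausted` nothing is left to restore at the last of them.
  Stable : Deletion G → Set
  Stable F = ∀ j → j < suc (missing G F) → missing G F ≤ missing G (Stage.reroute F j)

  -- Descent with `m` as fuel: a cheaper rerouting is again a solution and strictly lowers
  -- `missing`.
  stabilise : ∀ m F → missing G F ≤ m → HFree ℋ (result G F) →
              ∃[ F′ ] (HFree ℋ (result G F′) × missing G F′ ≤ missing G F × Stable F′)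
  stabilise zero    F F≤0 free = F , free , ≤-refl , λ _ _ → ≤-trans F≤0 z≤n
  stabilise (suc m) F F≤m free
    with anyUpTo? (λ j → missing G (Stage.reroute F j) <? missing G F) (suc (missing G F))
  ... | no stable = F , free , ≤-refl , λ j j< → ≮⇒≥ (λ fewer → stable (j , j< , fewer))
  ... | yes (j , _ , fewer) =
    let (F′ , free′ , F′≤ , stable) = stabilise m (Stage.reroute F j) (≤-pred (≤-trans fewer F≤m))
          (Stage.reroute-free F j {ℋ} connected free (copies-in-shell F j))
    in F′ , free′ , ≤-trans F′≤ (<⇒≤ fewer) , stable

  module _ (F : Deletion G) (stable : Stable F) where

    -- Over ordered pairs these are 2 r_j and 2 t_j.
    rest front : ℕ → ℕ
    rest j  = restored F {Shell j} (Shell? j)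
    front j = Stage.frontier F j

    -- By stability, what `keep` saves on `F` cannot exceed what `reroute` adds to `keep`.
    rest-bound : ∀ {j} → j < suc (missing G F) → rest j ≤ 2 * Δ * front j
    rest-bound {j} j< = +-cancelˡ-≤ (missing G (Stage.keep F j)) _ _
      (≤-trans (Stage.missing-keep F j) (≤-trans (stable j j<) (Stage.missing-reroute F j deg≤Δ)))

    rest-step : ∀ j → rest (suc j) + front j ≤ rest j
    rest-step j = Stage.restored-frontier F j (Shell-suc j)

    -- Adding `rest j` ≤ 2Δ `front j` to 2Δ times `rest (suc j)` gives at most 2Δ `rest j`, so each
    -- stage shrinks `rest` by the factor (2Δ - 1) / 2Δ.
    rest-decay : ∀ j → j ≤ missing G F →
                 (2 * Δ) ^ j * rest j ≤ (2 * Δ ∸ 1) ^ j * missing G F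
    rest-decay zero _ = *-monoʳ-≤ 1 (≤-trans (m≤n+m (rest 0) _) (Stage.missing-keep F 0))
    rest-decay (suc j) j<m = begin
      2 * Δ * (2 * Δ) ^ j * rest (suc j)
        ≡⟨ swapˡ (2 * Δ) ((2 * Δ) ^ j) (rest (suc j)) ⟩
      (2 * Δ) ^ j * (2 * Δ * rest (suc j))
        ≤⟨ *-monoʳ-≤ ((2 * Δ) ^ j) shrink ⟩
      (2 * Δ) ^ j * ((2 * Δ ∸ 1) * rest j)
        ≡⟨ regroup ((2 * Δ) ^ j) (2 * Δ ∸ 1) (rest j) ⟩
      (2 * Δ ∸ 1) * ((2 * Δ) ^ j * rest j)
        ≤⟨ *-monoʳ-≤ (2 * Δ ∸ 1) (rest-decay j (<⇒≤ j<m)) ⟩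
      (2 * Δ ∸ 1) * ((2 * Δ ∸ 1) ^ j * missing G F)
        ≡⟨ *-assoc (2 * Δ ∸ 1) _ _ ⟨
      (2 * Δ ∸ 1) ^ suc j * missing G F ∎
      where
      open ≤-Reasoning
      swapˡ : ∀ x y z → x * y * z ≡ y * (x * z)
      swapˡ = solve-∀
      regroup : ∀ x y z → x * (y * z) ≡ y * (x * z)
      regroup = solve-∀
      shrink : 2 * Δ * rest (suc j) ≤ (2 * Δ ∸ 1) * rest j
      shrink = begin
        2 * Δ * rest (suc j)                     ≤⟨ m+n≤o⇒m≤o∸n (2 * Δ * rest (suc j)) total ⟩
        2 * Δ * rest j ∸ rest j                  ≡⟨ cong (2 * Δ * rest j ∸_) (*-identityˡ (rest j)) ⟨
        2 * Δ * rest j ∸ 1 * rest j              ≡⟨ *-distribʳ-∸ (rest j) (2 * Δ) 1 ⟨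
        (2 * Δ ∸ 1) * rest j                     ∎
        where
        total : 2 * Δ * rest (suc j) + rest j ≤ 2 * Δ * rest j
        total = begin
          2 * Δ * rest (suc j) + rest j               ≤⟨ +-monoʳ-≤ (2 * Δ * rest (suc j)) (rest-bound {j} (≤-trans j<m (n≤1+n _))) ⟩
          2 * Δ * rest (suc j) + 2 * Δ * front j      ≡⟨ *-distribˡ-+ (2 * Δ) (rest (suc j)) (front j) ⟨
          2 * Δ * (rest (suc j) + front j)            ≤⟨ *-monoʳ-≤ (2 * Δ) (rest-step j) ⟩
          2 * Δ * rest j                              ∎

    -- An empty frontier forces `rest j` to vanish by `rest-bound`; a nonempty one lowers `rest` by
    -- at least 1. Hence nothing is left at stage `missing G F`, the last one that stability covers.
    rest-exhausted : ∀ j → j ≤ missing G F → rest j ≡ 0 ⊎ rest j + j ≤ missing G F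
    rest-exhausted zero _ = inj₂ (≤-trans (≤-reflexive (+-identityʳ (rest 0)))
      (≤-trans (m≤n+m (rest 0) _) (Stage.missing-keep F 0)))
    rest-exhausted (suc j) j<m with rest-exhausted j (<⇒≤ j<m) | front j in eq
    ... | inj₁ rest≡0 | _     = inj₁ (n≤0⇒n≡0 (≤-trans (m≤m+n (rest (suc j)) (front j))
                                  (≤-trans (rest-step j) (≤-reflexive rest≡0))))
    ... | inj₂ _      | zero  = inj₁ (n≤0⇒n≡0 (≤-trans (m≤m+n (rest (suc j)) (front j))
      (≤-trans (rest-step j) (≤-trans (rest-bound {j} (≤-trans j<m (n≤1+n _)))
        (≤-reflexive (trans (cong (2 * Δ *_) eq) (*-zeroʳ (2 * Δ))))))))
    ... | inj₂ rest≤  | suc t = inj₂ (begin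
      rest (suc j) + suc j       ≡⟨ +-suc (rest (suc j)) j ⟩
      suc (rest (suc j)) + j     ≤⟨ +-monoˡ-≤ j (begin
        suc (rest (suc j))         ≡⟨ +-comm 1 (rest (suc j)) ⟩
        rest (suc j) + 1           ≤⟨ +-monoʳ-≤ (rest (suc j)) (s≤s z≤n) ⟩
        rest (suc j) + suc t       ≡⟨ cong (rest (suc j) +_) eq ⟨
        rest (suc j) + front j     ≤⟨ rest-step j ⟩
        rest j                     ∎) ⟩
      rest j + j                 ≤⟨ rest≤ ⟩
      missing G F                ∎)
      where open ≤-Reasoning

    FirstInShell : ℕ → Vertex G → Vertex G → Set
    FirstInShell j u v = j ≤ missing G F × Restored F (Shell j) u v × Shell (suc j) u

    -- The edge is followed outwards until a shell first contains both ends; the stage recorded is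
    -- the one before, where the edge still counts as restored.
    shell-search : ∀ {u v} → Deleted F u v → ∀ j → j ≤ missing G F →
                   Restored F (Shell j) u v ⊎ ∃[ i ] FirstInShell i u v
    shell-search deleted zero _ = inj₁ (deleted , proj₁)
    shell-search {u} {v} deleted (suc j) j<m with shell-search deleted j (<⇒≤ j<m)
    ... | inj₂ found = inj₂ found
    ... | inj₁ back with Shell? (suc j) u ×-dec Shell? (suc j) v
    ...   | yes (Su , _) = inj₂ (j , <⇒≤ j<m , back , Su)
    ...   | no ¬S         = inj₁ (deleted , ¬S)

    -- An edge gives two ordered pairs. This 2 cancels the one in `missing G F` ≤ 2k, leaving b^j ≤
    -- k exactly.
    restored⇒rest≥2 : ∀ j {u v} → Restored F (Shell j) u v → 2 ≤ rest j
    restored⇒rest≥2 j {u} {v} back = subst (2 ≤_) (≡-sym even) (*-monoʳ-≤ 2 (half (edges P) (begin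
      1            ≤⟨ ≤pairs P (dec-true (R? u v) back) ⟩
      rest j       ≡⟨ even ⟩
      2 * edges P  ∎)))
      where
      open ≤-Reasoning
      R? : ∀ u v → Dec (Restored F (Shell j) u v)
      R? = Restored? F {Shell j} (Shell? j)
      P : Vertex G → Vertex G → Bool
      P u v = does (R? u v)
      even : rest j ≡ 2 * edges P
      even = pairs≡2*edges P
        (λ u v → does-⇔ (mk⇔ (Restored-sym F (Shell j)) (Restored-sym F (Shell j))) (R? u v) (R? v u))
        (λ u → dec-false (R? u u) λ ((e , _) , _) → contradiction (trans (≡-sym e) (irrefl G u)) λ ())
      half : ∀ m → 1 ≤ 2 * m → 1 ≤ m
      half (suc m) _ = s≤s z≤n

    -- If the edge is still restored at stage j, decay yields 2 b^j ≤ b^j `rest j` ≤ `missing G F` ≤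
    -- 2k, while the next shell already contains u.
    deleted-in-shell : ∀ {k u v} → missing G F ≤ 2 * k → Deleted F u v →
                       ∃[ j ] ((2 * Δ) ^ j ≤ k * (2 * Δ ∸ 1) ^ j × Near ℋ G (j * D) u)
    deleted-in-shell {k} {u} {v} F≤2k deleted with shell-search deleted (missing G F) ≤-refl
    -- The edge would survive outside every shell searched, but `rest` is exhausted by then.
    ... | inj₁ back = contradiction (restored⇒rest≥2 (missing G F) back) (<⇒≱ (s≤s
      (≤-trans (≤-reflexive rest≡0) z≤n)))
      where
      rest≡0 : rest (missing G F) ≡ 0
      rest≡0 with rest-exhausted (missing G F) ≤-refl
      ... | inj₁ eq = eq
      ... | inj₂ le = n≤0⇒n≡0 (+-cancelʳ-≤ (missing G F) _ _ le)
    ... | inj₂ (j , j≤m , back , near) = j , *-cancelʳ-≤ _ _ 2 (begin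
      (2 * Δ) ^ j * 2                    ≤⟨ *-monoʳ-≤ ((2 * Δ) ^ j) (restored⇒rest≥2 j back) ⟩
      (2 * Δ) ^ j * rest j               ≤⟨ rest-decay j j≤m ⟩
      (2 * Δ ∸ 1) ^ j * missing G F      ≤⟨ *-monoʳ-≤ ((2 * Δ ∸ 1) ^ j) F≤2k ⟩
      (2 * Δ ∸ 1) ^ j * (2 * k)          ≡⟨ regroup ((2 * Δ ∸ 1) ^ j) k ⟩
      k * (2 * Δ ∸ 1) ^ j * 2            ∎) , near
      where
      open ≤-Reasoning
      regroup : ∀ x k → x * (2 * k) ≡ k * x * 2
      regroup = solve-∀

-- The kernel

deletionEdge : ∀ G → Deletion G → Vertex G → Vertex G → Bool
deletionEdge G F i j = (toℕ i <ᵇ toℕ j) ∧ (adj G i j ∧ not (adj' F i j))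

-- Repeats i once for each deleted edge with lower end i, so that the lengths add up to the number
-- of deleted edges.
lowerEndsAt : ∀ G → Deletion G → Vertex G → List (Vertex G)
lowerEndsAt G F i = map (λ _ → i) (filter (λ j → deletionEdge G F i j Bool.≟ true) (allFin (n G)))

lowerEnds : ∀ G → Deletion G → List (Vertex G)
lowerEnds G F = concatMap (lowerEndsAt G F) (allFin (n G))

length-lowerEnds : ∀ G F → length (lowerEnds G F) ≤ deletedCount G F
length-lowerEnds G F = ≤-trans (≤-reflexive (length-concatMap (lowerEndsAt G F) (allFin (n G))))
  (∑-mono {f = length ∘ lowerEndsAt G F} λ i → ≤-reflexive (trans
    (length-map (λ _ → i) (filter (λ j → deletionEdge G F i j Bool.≟ true) (allFin (n G))))
    (length-filter-sum (deletionEdge G F i) (allFin (n G)))))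

<⇒lowerEnd : ∀ {G} (F : Deletion G) {u v} → toℕ u < toℕ v → Deleted F u v → u ∈ lowerEnds G F
<⇒lowerEnd {G} F {u} {v} u<v deleted = ∈-concatMap⁺ (lowerEndsAt G F) (lose (∈-allFin u) (∈-map⁺ (λ _ → u)
  (∈-filter⁺ (λ w → deletionEdge G F u w Bool.≟ true) (∈-allFin v)
    (∧-true⁺ (dec-true (toℕ u <? toℕ v) u<v) (Deleted⇒ F deleted)))))

Deleted⇒lowerEnd : ∀ {G} (F : Deletion G) {u v} → Deleted F u v →
                   u ∈ lowerEnds G F ⊎ v ∈ lowerEnds G F
Deleted⇒lowerEnd {G} F {u} {v} deleted@(before , after) with <-cmp (toℕ u) (toℕ v)
... | tri< u<v _ _ = inj₁ (<⇒lowerEnd F u<v deleted)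
... | tri> _ _ v<u =
  inj₂ (<⇒lowerEnd F v<u (trans (sym G v u) before , trans (sym' F v u) after))
... | tri≈ _ u≡v _ with toℕ-injective u≡v
...   | refl = contradiction (trans (≡-sym before) (irrefl G u)) λ ()

module Copies {ℋ : List Graph} {D : ℕ}
              (diameter : ∀ {H} → H ∈ ℋ → ∀ x y → DistLe H x y D)
              {Δ : ℕ} (2≤Δ : 2 ≤ Δ) {G : Graph} (deg≤Δ : MaxDegreeLe G Δ) where

  copy-walk : ∀ {H} → H ∈ ℋ → ((f , _) : InducedEmbedding H G) → ∀ x y → DistLe G (f x) (f y) D
  copy-walk H∈ℋ (f , _ , f-adj) x y with diameter H∈ℋ x y
  ... | ℓ , ℓ≤D , w = ℓ , ℓ≤D , Walk-map f (λ {a} {b} e → trans (≡-sym (f-adj a b)) e) w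

  -- By its diameter, a copy lies in the ball of radius D around any one of its vertices.
  copy-size : ∀ {H} → H ∈ ℋ → InducedEmbedding H G → Vertex H → n H ≤ Δ ^ suc D
  copy-size H∈ℋ copy@(f , injective , _) x = ≤-trans
    (covering-length (ball G D (f x)) (λ {i} {j} → injective {i} {j}) λ y →
      let (_ , ℓ≤D , w) = copy-walk H∈ℋ copy x y in Walk⇒∈ball w ℓ≤D)
    (<⇒≤ (length-ball 2≤Δ deg≤Δ D (f x)))

  -- A kept vertex is within N of some vertex of a copy, the solution deletes an edge of that copy,
  -- and the lower end of this edge is within D of that vertex. So at most k balls of radius D + N
  -- cover everything.
  kept-size : ∀ {k N m} {ι : Fin m → Vertex G} → Injective _≡_ _≡_ ι →
              (∀ i → Kept ℋ Δ D k G (ι i)) → (∀ d → ThresholdLe Δ D k d → d ≤ N) →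
              YesInstance ℋ G k → m ≤ k * Δ ^ suc (D + N)
  kept-size {k} {N} {m} {ι} ι-injective kept d≤N (F , F≤k , free) = begin
    m                                             ≤⟨ covering-length cover ι-injective covered ⟩
    length cover                                  ≤⟨ length-concatMap-≤ (ball G (D + N))
                                                      (λ v → <⇒≤ (length-ball 2≤Δ deg≤Δ (D + N) v)) (lowerEnds G F) ⟩
    length (lowerEnds G F) * Δ ^ suc (D + N)      ≤⟨ *-monoˡ-≤ (Δ ^ suc (D + N)) (≤-trans (length-lowerEnds G F) F≤k) ⟩
    k * Δ ^ suc (D + N)                           ∎
    where
    open ≤-Reasoning
    cover : List (Vertex G)
    cover = concatMap (ball G (D + N)) (lowerEnds G F)
    covered : ∀ i → ι i ∈ cover
    covered i with kept i
    ... | _ , (H , H∈ℋ , copy@(f , _) , x , refl) , d , w , threshold = from-end lower-end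
      where
      lower-end : ∃[ z ] (f z ∈ lowerEnds G F)
      lower-end with copy-hits-solution {ℋ} F free {H} H∈ℋ copy
      ... | y , z , deleted with Deleted⇒lowerEnd F deleted
      ...   | inj₁ y∈ = y , y∈
      ...   | inj₂ z∈ = z , z∈
      from-end : ∃[ z ] (f z ∈ lowerEnds G F) → ι i ∈ cover
      from-end (z , z∈) = let (_ , ℓ≤D , w′) = copy-walk H∈ℋ copy z x in
        ∈-concatMap⁺ (ball G (D + N)) (lose z∈
          (Walk⇒∈ball (Walk-++ w′ (Walk-reverse w)) (+-mono-≤ ℓ≤D (d≤N d threshold))))

-- If nothing is deleted, the identity is a forbidden copy of `H` in itself.
no-0-deletion : ∀ {ℋ H} → H ∈ ℋ → ¬ YesInstance ℋ H 0
no-0-deletion {H = H} H∈ℋ (F , F≤0 , free) with agree-or-deleted F id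
... | inj₁ agree = free H H∈ℋ (id , id , agree)
... | inj₂ (u , v , deleted) = contradiction (begin
  1                    ≤⟨ ≤pairs (λ i j → adj H i j ∧ not (adj' F i j)) {u} {v} (Deleted⇒ F deleted) ⟩
  missing H F          ≡⟨ missing≡2*deletedCount H F ⟩
  2 * deletedCount H F ≤⟨ *-monoʳ-≤ 2 F≤0 ⟩
  0                    ∎) (<⇒≱ ≤-refl)
  where open ≤-Reasoning

missing≤⇒deletedCount≤ : ∀ {G G′ F F′} → missing G F ≤ missing G′ F′ →
                         deletedCount G F ≤ deletedCount G′ F′
missing≤⇒deletedCount≤ {G} {G′} {F} {F′} le = *-cancelˡ-≤ 2
  (subst₂ _≤_ (missing≡2*deletedCount G F) (missing≡2*deletedCount G′ F′) le)

-- Moving deletions between a graph and an induced subgraph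

module InducedSubgraph {G G′ : Graph} (ι : Vertex G′ → Vertex G) (ι-injective : Injective _≡_ _≡_ ι)
                       (ι-adj : ∀ i j → adj G′ i j ≡ adj G (ι i) (ι j)) where

  restrict : Deletion G → Deletion G′
  restrict F = record
    { adj'    = λ i j → adj' F (ι i) (ι j)
    ; sym'    = λ i j → sym' F (ι i) (ι j)
    ; irrefl' = λ i → irrefl' F (ι i)
    ; sub'    = λ i j e → trans (ι-adj i j) (sub' F (ι i) (ι j) e)
    }

  restrict-missing : ∀ F → missing G′ (restrict F) ≤ missing G F
  restrict-missing F = pairs-matching (λ i a → ι i ≟ a)
    (λ { refl eq → ι-injective (≡-sym eq) })
    (λ i j _ → ι i , ι j , refl , refl)
    (λ { {i} {j} refl refl → trans (cong (_∧ not (adj' F (ι i) (ι j))) (≡-sym (ι-adj i j))) })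

  restrict-yes : ∀ {ℋ k} → YesInstance ℋ G k → YesInstance ℋ G′ k
  restrict-yes (F , F≤k , free) = restrict F ,
    ≤-trans (missing≤⇒deletedCount≤ {G′} {G} {restrict F} {F} (restrict-missing F)) F≤k ,
    λ H H∈ℋ copy → free H H∈ℋ
      (InducedEmbedding-∘ {H} {result G′ (restrict F)} {result G F} copy
        (ι , (λ {i} {j} → ι-injective {i} {j}) , λ _ _ → refl))

  module _ (F : Deletion G′) where

    -- Also holds for images of pairs that were never adjacent. `cut` leaves those nonadjacent in
    -- any case, so `extend` deletes only images of edges deleted by `F`.
    DeletedBelow : Vertex G → Vertex G → Set
    DeletedBelow u v = ∃[ i ] ∃[ j ] (ι i ≡ u × ι j ≡ v × adj' F i j ≡ false)

    DeletedBelow? : ∀ u v → Dec (DeletedBelow u v)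
    DeletedBelow? u v =
      any? (λ i → any? (λ j → (ι i ≟ u) ×-dec ((ι j ≟ v) ×-dec (adj' F i j Bool.≟ false))))

    ¬DeletedBelow-sym : ∀ {u v} → ¬ DeletedBelow u v → ¬ DeletedBelow v u
    ¬DeletedBelow-sym ¬d (i , j , i↦v , j↦u , e) = ¬d (j , i , j↦u , i↦v , trans (sym' F j i) e)

    extend : Deletion G
    extend = cut G (λ u v → ¬? (DeletedBelow? u v)) ¬DeletedBelow-sym

    extend-deletes : ∀ {u v} → Deleted extend u v →
                     ∃[ i ] ∃[ j ] (ι i ≡ u × ι j ≡ v × Deleted F i j)
    extend-deletes {u} {v} deleted
      with cut-deletes G (λ u v → ¬? (DeletedBelow? u v)) ¬DeletedBelow-sym deleted
    ... | before , ¬¬below with decidable-stable (DeletedBelow? u v) ¬¬below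
    ...   | i , j , refl , refl , after = i , j , refl , refl , trans (ι-adj i j) before , after

    -- Makes ι an induced embedding of the subgraph after `F` into the large graph after `extend`.
    extend-image : ∀ i j → adj' extend (ι i) (ι j) ≡ adj' F i j
    extend-image i j = Bool.⇔→≡ {z = true} (mk⇔ down up)
      where
      down : adj' extend (ι i) (ι j) ≡ true → adj' F i j ≡ true
      down e = Bool.¬-not λ after →
        does⇒ (¬? (DeletedBelow? (ι i) (ι j))) (proj₂ (∧-true⁻ {adj G (ι i) (ι j)} e))
              (i , j , refl , refl , after)
      up : adj' F i j ≡ true → adj' extend (ι i) (ι j) ≡ true
      up e = ∧-true⁺ (trans (≡-sym (ι-adj i j)) (sub' F i j e))
        (dec-true (¬? (DeletedBelow? (ι i) (ι j))) ¬below)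
        where
        ¬below : ¬ DeletedBelow (ι i) (ι j)
        ¬below (i′ , j′ , i′↦ , j′↦ , after) with ι-injective i′↦ | ι-injective j′↦
        ... | refl | refl = contradiction (trans (≡-sym e) after) λ ()

    extend-missing : missing G extend ≤ missing G′ F
    extend-missing = pairs-matching (λ a i → ι i ≟ a)
      (λ p q → trans (≡-sym p) q)
      (λ u v d → let (i , j , i↦u , j↦v , _) = extend-deletes (⇒Deleted extend d) in i , j , i↦u , j↦v)
      λ { {i = u} {v} {i} {j} refl refl d → image d }
      where
      image : ∀ {i j} → adj G (ι i) (ι j) ∧ not (adj' extend (ι i) (ι j)) ≡ true →
              adj G′ i j ∧ not (adj' F i j) ≡ true
      image {i} {j} d = trans (cong₂ (λ p q → p ∧ not q) (ι-adj i j) (≡-sym (extend-image i j))) d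

    -- A copy inside the image of ι pulls back to a copy after `F`.
    extend-free : ∀ {ℋ} → HFree ℋ (result G′ F) →
      (∀ {H} → H ∈ ℋ → ((f , _) : InducedEmbedding H (result G extend)) → ∀ x → ∃[ i ] (ι i ≡ f x)) →
      HFree ℋ (result G extend)
    extend-free free in-image H H∈ℋ copy@(f , injective , f-adj) = free H H∈ℋ
      (g , (λ {x} {y} eq → injective (trans (≡-sym (ιg x)) (trans (cong ι eq) (ιg y)))) , g-adj)
      where
      g : Vertex H → Vertex G′
      g x = proj₁ (in-image H∈ℋ copy x)
      ιg : ∀ x → ι (g x) ≡ f x
      ιg x = proj₂ (in-image H∈ℋ copy x)
      g-adj : ∀ x y → adj H x y ≡ adj' F (g x) (g y)
      g-adj x y = trans (f-adj x y) (trans (cong₂ (adj' extend) (≡-sym (ιg x)) (≡-sym (ιg y)))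
                                           (extend-image (g x) (g y)))

induced-degree : ∀ {G G′} (ι : Vertex G′ → Vertex G) → Injective _≡_ _≡_ ι →
                 (∀ i j → adj G′ i j ≡ adj G (ι i) (ι j)) → ∀ {Δ} → MaxDegreeLe G Δ → MaxDegreeLe G′ Δ
induced-degree {G} {G′} ι ι-injective ι-adj deg≤Δ v = ≤-trans
  (∑-matching (λ i a → ι i ≟ a) (λ { refl eq → ι-injective (≡-sym eq) })
    (λ i → inj₂ (ι i , refl , ≤-reflexive (cong indicator (ι-adj v i)))))
  (deg≤Δ (ι v))

theorem1 : (ℋ : List Graph) → All Connected ℋ →
    (D : ℕ) → IsMaxDiameter ℋ D →
    (Δ : ℕ) → 2 ≤ Δ →
    (G : Graph) → (k : ℕ) → 1 ≤ k →
    MaxDegreeLe G Δ →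
    (∃[ v ] InVH ℋ G v) →
    (G' : Graph) → (ι : Fin (n G') → Fin (n G)) → IsStep1Graph ℋ Δ D k G G' ι →
    (H₀ : Graph) → H₀ ∈ ℋ → (∀ H → H ∈ ℋ → n H₀ ≤ n H) →
    ((¬ BoundLe Δ D k (n G')) →
    BoundLe Δ D k (n H₀) × (YesInstance ℋ H₀ 0 ⇔ YesInstance ℋ G k)) ×
    (BoundLe Δ D k (n G') →
    BoundLe Δ D k (n G') × (YesInstance ℋ G' k ⇔ YesInstance ℋ G k))
theorem1 ℋ connected D (diameter , _) Δ 2≤Δ G k 1≤k deg≤Δ (_ , H₁ , H₁∈ℋ , copy₁ , x₁ , _)
  G' ι (ι-injective , ι-adj , kept⇒image , kept) H₀ H₀∈ℋ H₀-smallest =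
  -- When G' is too large, (H₀, 0) and (G, k) are both no-instances, so the equivalence holds.
  (λ large → boundLe-from-balls Δ D k (n H₀) 2≤Δ (λ N _ → H₀-size N) ,
     mk⇔ (λ solution₀ → contradiction solution₀ (no-0-deletion H₀∈ℋ))
         (λ solution → contradiction (yes⇒boundLe solution) large)) ,
  (λ small → small , mk⇔ extend-yes restrict-yes)
  where
  open InducedSubgraph {G} {G'} ι ι-injective ι-adj
  module C = Copies {ℋ} {D} (λ H∈ℋ → diameter _ H∈ℋ) {Δ} 2≤Δ {G} deg≤Δ
  module E = Descent {ℋ} (All.lookup connected) {D} (λ H∈ℋ → diameter _ H∈ℋ) {G'} {Δ}
                     (induced-degree {G} {G'} ι ι-injective ι-adj deg≤Δ)
  instance
    Δ≢0 : NonZero Δ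
    Δ≢0 = >-nonZero (<⇒≤ 2≤Δ)
    k≢0 : NonZero k
    k≢0 = >-nonZero 1≤k

  H₀-size : ∀ N → n H₀ ≤ k * Δ ^ suc (D + N)
  H₀-size N = begin
    n H₀                  ≤⟨ H₀-smallest H₁ H₁∈ℋ ⟩
    n H₁                  ≤⟨ C.copy-size H₁∈ℋ copy₁ x₁ ⟩
    Δ ^ suc D             ≤⟨ ^-monoʳ-≤ Δ (s≤s (m≤m+n D N)) ⟩
    Δ ^ suc (D + N)       ≤⟨ m≤n*m (Δ ^ suc (D + N)) k ⟩
    k * Δ ^ suc (D + N)   ∎
    where open ≤-Reasoning

  yes⇒boundLe : YesInstance ℋ G k → BoundLe Δ D k (n G')
  yes⇒boundLe solution = boundLe-from-balls Δ D k (n G') 2≤Δ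
    λ N d≤N → C.kept-size {k} {N} ι-injective kept d≤N solution

  threshold : ∀ j d → (2 * Δ) ^ j ≤ k * (2 * Δ ∸ 1) ^ j → d ≤ D + j * D → ThresholdLe Δ D k d
  threshold = threshold-from-log (2 * Δ) (2 * Δ ∸ 1) k D (1≤2Δ∸1 2≤Δ) (2Δ∸1<2Δ 2≤Δ)

  extend-yes : YesInstance ℋ G' k → YesInstance ℋ G k
  extend-yes (F₀ , F₀≤k , free₀)
    with E.stabilise (missing G' F₀) F₀ ≤-refl free₀
  ... | F , free , F≤F₀ , stable = extend F ,
    ≤-trans (missing≤⇒deletedCount≤ {G} {G'} {extend F} {F₀} (≤-trans (extend-missing F) F≤F₀)) F₀≤k ,
    extend-free F {ℋ} free λ H∈ℋ copy x → kept⇒image _ (copy-kept H∈ℋ copy x)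
    where
    F≤2k : missing G' F ≤ 2 * k
    F≤2k = ≤-trans F≤F₀ (≤-trans (≤-reflexive (missing≡2*deletedCount G' F₀)) (*-monoʳ-≤ 2 F₀≤k))
    -- All copies left after `extend F` lie in V(G'), where `F` has already destroyed them.
    copy-kept : ∀ {H} → H ∈ ℋ → ((f , _) : InducedEmbedding H (result G (extend F))) →
                ∀ x → Kept ℋ Δ D k G (f x)
    copy-kept {H} H∈ℋ copy@(f , injective , f-adj) x with copy-original-or-created (extend F) {H} copy
    -- An original copy is at distance 0 from V_ℋ; with exponent 0 the logarithmic condition is just
    -- 1 ≤ k.
    ... | inj₁ agree = f x , (H , H∈ℋ , (f , (λ {y} {z} → injective {y} {z}) , agree) , x , refl) ,
      0 , nil , threshold 0 0 (≤-trans 1≤k (≤-reflexive (≡-sym (*-identityʳ k)))) z≤n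
    ... | inj₂ (y , z , deleted) with extend-deletes F deleted | diameter H H∈ℋ x y
    ...   | i , j , i↦y , j↦z , deletedF | ℓ , ℓ≤D , w
      with E.deleted-in-shell F stable {k} F≤2k deletedF
    ...     | t , log , u , u∈VH , ℓ′ , ℓ′≤tD , w′ =
      -- The walk uses at most D steps inside the copy to reach an end of a deleted edge, then at
      -- most tD steps inside G' to reach V_ℋ, where b^t ≤ k.
      ι u , InVH-embedding {ℋ} {G'} {G} (ι , (λ {a} {b} → ι-injective {a} {b}) , ι-adj) u∈VH , ℓ + ℓ′ ,
      Walk-++ (Walk-map f (λ {a} {b} e → sub' (extend F) (f a) (f b) (trans (≡-sym (f-adj a b)) e)) w)
        (subst (λ v → Walk G v (ι u) ℓ′) i↦y
          (Walk-map ι (λ {a} {b} e → trans (≡-sym (ι-adj a b)) e) w′)) ,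
      threshold t (ℓ + ℓ′) log (+-mono-≤ ℓ≤D ℓ′≤tD)
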